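{- Let $G$ be an almost bipartite non-König-Egerváry graph with unique odd cycle $C$. Then: (i) $\mathrm{corona}(G)\cup N(\mathrm{core}(G))=V(G)$; (ii) if $G$ is connected, then $\mathrm{corona}(G)=V(C)\cup\left(\bigcup_{y\in V(C)}\mathrm{corona}(D_y-y)\right)$.
   Context: All graphs are finite, undirected, without loops or multiple edges. $N(A)=\bigcup_{v\in A}N(v)$ denotes the (open) neighborhood of a vertex set $A$. $\alpha(G)$ is the maximum size of an independent set, $\mu(G)$ the maximum size of a matching, $n(G)=|V(G)|$. $G$ is a König-Egerváry graph if $\alpha(G)+\mu(G)=n(G)$, and non-König-Egerváry otherwise. A cycle is a closed trail whose only repeated vertices are the first and the last. $G$ is almost bipartite if it has a unique odd cycle, denoted $C$, with vertex set $V(C)$ and edge set $E(C)$. For $y\in V(C)$, $D_y$ is the connected component containing $y$ of the graph $G-E(C)$ (obtained by deleting the edges of $C$); it is bipartite. $D_y-y$ is the graph obtained from $D_y$ by deleting the vertex $y$ (possibly the graph with no vertices, whose corona is empty). $\mathrm{core}(G)$ is the intersection, and $\mathrm{corona}(G)$ the union, of all maximum independent sets of $G$. -}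

module Defs where

open import Data.Fin using (Fin; zero; suc; inject₁; fromℕ)
open import Data.Fin.Properties using (_≟_; any?)
open import Data.Fin.Subset using (Subset; _∈_; _⊆_; _⊃_; _∩_; _∪_; ∁; ⁅_⁆; ∣_∣; Nonempty)
open import Data.Fin.Subset.Induction using (Acc; acc; ⊃-wellFounded)
open import Data.Fin.Subset.Properties
  using (_∈?_; x∈⁅x⁆; x∈⁅y⁆⇒x≡y; x∈p∩q⁺; x∈p∪q⁻; p⊆p∪q; q⊆p∪q)
open import Data.List using (List; length)
open import Data.List.Relation.Unary.All using (All)
open import Data.List.Relation.Unary.AllPairs using (AllPairs)
open import Data.Nat using (ℕ; suc; _+_; _≤_; _<_)
open import Data.Nat.Divisibility using (_∤_)
open import Data.Product using (Σ; ∃; ∃₂; _×_; _,_; proj₁; uncurry)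
open import Data.Sum using (_⊎_; inj₁; inj₂)
open import Function.Definitions using (Injective)
open import Level using (0ℓ)
open import Relation.Binary.Construct.Closure.ReflexiveTransitive using (Star; ε; _◅_; _◅◅_)
import Relation.Binary.Core as B
open import Relation.Binary.Definitions using (Decidable; Symmetric; Irreflexive)
open import Relation.Binary.PropositionalEquality using (_≡_; _≢_; refl)
open import Relation.Nullary using (¬_; yes; no; _×-dec_; _⊎-dec_; ¬?)
open import Relation.Nullary.Decidable using (decidable-stable)
open import Relation.Unary using (Pred; _≐_)

-- A finite simple graph whose vertex set V is a subset of an ambient Fin n,
-- so that subgraphs (in particular on fewer or no vertices) have the same type.
record Graph (n : ℕ) : Set₁ where
  field
    V        : Subset n
    Adj      : B.Rel (Fin n) 0ℓ
    adj?     : Decidable Adj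
    adj-sym  : Symmetric Adj
    adj-irr  : Irreflexive _≡_ Adj
    adj⇒∈V   : ∀ {u v} → Adj u v → u ∈ V

open Graph public

private variable
  n : ℕ

order : Graph n → ℕ
order G = ∣ V G ∣

Edge : ℕ → Set
Edge n = Fin n × Fin n

-- Equality of {u,v} and {x,y} as unordered pairs.
SameEdge : Edge n → Edge n → Set
SameEdge (u , v) (x , y) = (u ≡ x × v ≡ y) ⊎ (u ≡ y × v ≡ x)

sameEdge? : Decidable (SameEdge {n})
sameEdge? (u , v) (x , y) = (u ≟ x ×-dec v ≟ y) ⊎-dec (u ≟ y ×-dec v ≟ x)

N : Graph n → Pred (Fin n) 0ℓ → Pred (Fin n) 0ℓ
N G A w = ∃ λ v → A v × Adj G v w

Independent : Graph n → Subset n → Set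
Independent G S = S ⊆ V G × (∀ {u v} → u ∈ S → v ∈ S → ¬ Adj G u v)

MaximumIndependent : Graph n → Subset n → Set
MaximumIndependent G S = Independent G S × (∀ T → Independent G T → ∣ T ∣ ≤ ∣ S ∣)

core : Graph n → Pred (Fin n) 0ℓ
core G v = ∀ S → MaximumIndependent G S → v ∈ S

corona : Graph n → Pred (Fin n) 0ℓ
corona G v = ∃ λ S → MaximumIndependent G S × v ∈ S

DisjointEdges : Edge n → Edge n → Set
DisjointEdges (u , v) (x , y) = (u ≢ x × u ≢ y) × (v ≢ x × v ≢ y)

-- Pairwise disjointness makes the list repetition-free, so its length is
-- the number of edges of the matching.
Matching : Graph n → List (Edge n) → Set
Matching G M = All (uncurry (Adj G)) M × AllPairs DisjointEdges M

MaximumMatching : Graph n → List (Edge n) → Set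
MaximumMatching G M = Matching G M × (∀ L → Matching G L → length L ≤ length M)

-- α(G) = a.
IsIndependenceNumber : Graph n → ℕ → Set
IsIndependenceNumber G a = ∃ λ S → MaximumIndependent G S × ∣ S ∣ ≡ a

-- μ(G) = m.
IsMatchingNumber : Graph n → ℕ → Set
IsMatchingNumber G m = ∃ λ M → MaximumMatching G M × length M ≡ m

KönigEgerváry : Graph n → Set
KönigEgerváry G =
  ∃₂ λ a m → IsIndependenceNumber G a × IsMatchingNumber G m × a + m ≡ order G

-- A closed trail v₀ v₁ … v_len = v₀ of positive length in which the only
-- repetition of vertices is that of the first and the last.
record Cycle (G : Graph n) : Set where
  field
    len    : ℕ
    vertex : Fin (suc len) → Fin n

  edge : Fin len → Edge n
  edge i = vertex (inject₁ i) , vertex (suc i)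

  field
    nontrivial : 0 < len
    walk       : ∀ i → uncurry (Adj G) (edge i)
    trail      : ∀ i j → SameEdge (edge i) (edge j) → i ≡ j
    closed     : vertex zero ≡ vertex (fromℕ len)
    simple     : Injective _≡_ _≡_ (λ (i : Fin len) → vertex (inject₁ i))

open Cycle public

VC : {G : Graph n} → Cycle G → Pred (Fin n) 0ℓ
VC C v = ∃ λ i → vertex C i ≡ v

EC : {G : Graph n} → Cycle G → B.Rel (Fin n) 0ℓ
EC C u v = ∃ λ i → SameEdge (u , v) (edge C i)

Odd : {G : Graph n} → Cycle G → Set
Odd C = 2 ∤ len C

-- Cycles are identified when they are the same subgraph, i.e. up to the
-- choice of starting point and direction.
IsUniqueOddCycle : {G : Graph n} → Cycle G → Set
IsUniqueOddCycle {G = G} C =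
  Odd C × (∀ (C′ : Cycle G) → Odd C′ → VC C′ ≐ VC C × (EC C′ B.⇔ EC C))

Reachable : Graph n → B.Rel (Fin n) 0ℓ
Reachable G = Star (Adj G)

Connected : Graph n → Set
Connected G = Nonempty (V G) × (∀ {u v} → u ∈ V G → v ∈ V G → Reachable G u v)

reachableSet : (G : Graph n) (y : Fin n) → Σ (Subset n) λ S → (_∈ S) ≐ Reachable G y
reachableSet {n} G y =
  grow ⁅ y ⁆ (⊃-wellFounded ⁅ y ⁆) (x∈⁅x⁆ y) λ x∈ → start (x∈⁅y⁆⇒x≡y y x∈)
  where
  start : ∀ {x} → x ≡ y → Reachable G y x
  start refl = ε

  grow : (S : Subset n) → Acc _⊃_ S → y ∈ S →
         (∀ {x} → x ∈ S → Reachable G y x) →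
         Σ (Subset n) λ T → (_∈ T) ≐ Reachable G y
  grow S (acc rec) y∈S sound
    with any? (λ u → any? (λ w → (u ∈? S) ×-dec (adj? G u w ×-dec ¬? (w ∈? S))))
  ... | yes (u , w , u∈S , uw , w∉S) =
    grow (S ∪ ⁅ w ⁆)
         (rec (p⊆p∪q ⁅ w ⁆ , w , q⊆p∪q S ⁅ w ⁆ (x∈⁅x⁆ w) , w∉S))
         (p⊆p∪q ⁅ w ⁆ y∈S)
         (λ x∈ → step (x∈p∪q⁻ S ⁅ w ⁆ x∈))
    where
    reach-w : ∀ {x} → x ≡ w → Reachable G y x
    reach-w refl = sound u∈S ◅◅ (uw ◅ ε)

    step : ∀ {x} → x ∈ S ⊎ x ∈ ⁅ w ⁆ → Reachable G y x
    step (inj₁ x∈S) = sound x∈S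
    step (inj₂ x∈w) = reach-w (x∈⁅y⁆⇒x≡y w x∈w)
  ... | no none = S , sound , complete y∈S
    where
    complete : ∀ {u x} → u ∈ S → Reachable G u x → x ∈ S
    complete u∈S ε = u∈S
    complete {u} u∈S (_◅_ {j = w} uw wx) =
      complete (decidable-stable (w ∈? S) λ w∉S → none (u , w , u∈S , uw , w∉S)) wx

induced : Graph n → Subset n → Graph n
induced G S = record
  { V       = V G ∩ S
  ; Adj     = λ u v → Adj G u v × u ∈ S × v ∈ S
  ; adj?    = λ u v → adj? G u v ×-dec ((u ∈? S) ×-dec (v ∈? S))
  ; adj-sym = λ (uv , u∈S , v∈S) → adj-sym G uv , v∈S , u∈S
  ; adj-irr = λ eq (uv , _) → adj-irr G eq uv
  ; adj⇒∈V  = λ (uv , u∈S , _) → x∈p∩q⁺ (adj⇒∈V G uv , u∈S)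
  }

_-ᵛ_ : Graph n → Fin n → Graph n
G -ᵛ y = induced G (∁ ⁅ y ⁆)

component : Graph n → Fin n → Graph n
component G y = induced G (proj₁ (reachableSet G y))

-- G − E(C): all vertices are kept.
deleteEdges : (G : Graph n) → Cycle G → Graph n
deleteEdges G C = record
  { V       = V G
  ; Adj     = λ u v → Adj G u v × ¬ EC C u v
  ; adj?    = λ u v → adj? G u v ×-dec ¬? (any? λ i → sameEdge? (u , v) (edge C i))
  ; adj-sym = λ (uv , uv∉C) →
      adj-sym G uv , λ (i , same) → uv∉C (i , swapEdge same)
  ; adj-irr = λ eq (uv , _) → adj-irr G eq uv
  ; adj⇒∈V  = λ (uv , _) → adj⇒∈V G uv
  }
  where
  swapEdge : ∀ {u v} {e : Edge _} → SameEdge (v , u) e → SameEdge (u , v) e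
  swapEdge (inj₁ (p , q)) = inj₂ (q , p)
  swapEdge (inj₂ (p , q)) = inj₁ (q , p)

D : (G : Graph n) → Cycle G → Fin n → Graph n
D G C y = component (deleteEdges G C) y

-- Let B = V(G) ∖ V(C), let H_y be the vertex set of D_y − y, and let e be an edge
-- of C.  Since every odd closed walk contains an odd cycle, G − e is bipartite.
-- Its two-colouring c_e gives the ends of e the same colour, and the vertices of C
-- of the other colour form a maximum stable set of G[V(C)]; comparing c_e with
-- c_f for two edges e, f of C shows that D_y meets C only in y.
--
-- For y on C, cut the branch D_y off G.  The result is bipartite, so by König's
-- theorem it has a stable set S and a matching M with |S| + |M| = n.  As G is not
-- König-Egerváry, S contains y, and S ∩ H_y is a maximum stable set of H_y
-- without neighbours on C.  Exchanging the branches one after the other gives a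
-- maximum stable set S₀ of G[B] without neighbours on C.  Hence the maximum
-- independent sets of G restrict to maximum ones on B, and S₀ can be completed
-- by a colour class of C through, or avoiding, any given vertex of C.  Part (ii)
-- follows by exchanging one more branch.  For part (i), fix a maximum matching
-- of G[B]: a vertex outside the corona lies in B, is matched, and its partner
-- belongs to every maximum independent set.

module Submission where

open import Defs
open import Data.Bool using (Bool; true; false; not; _xor_; if_then_else_)
open import Data.Bool.Properties
  using (¬-not; not-injective; not-involutive; not-distribˡ-xor; xor-same; xor-identityʳ; xor-annihilates-not)
  renaming (_≟_ to _≟ᵇ_)
open import Data.Empty using (⊥; ⊥-elim)
open import Data.Fin using (Fin; zero; suc; toℕ; inject₁; fromℕ; fromℕ<)
import Data.Fin as Fin
open import Data.Fin.Properties
  using (_≟_; any?; toℕ<n; toℕ-inject₁; toℕ-fromℕ; toℕ-fromℕ<; toℕ-injective)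
  renaming (suc-injective to fsuc-injective; <-cmp to <ᶠ-cmp; <⇒≢ to <ᶠ⇒≢)
open import Data.Fin.Relation.Unary.Top using (view; ‵fromℕ; ‵inj₁)
open import Data.Fin.Subset using (Subset; _∈_; _∉_; _⊆_; _∩_; _─_; _-_; ∁; ⁅_⁆; ∣_∣; Nonempty)
  renaming (_∪_ to infixr 6 _∪ˢ_)
open import Data.Fin.Subset.Properties
open import Data.List using (List; []; _∷_; _++_; length; allFin; filter; cartesianProduct)
open import Data.List.Membership.Propositional using (find; lose) renaming (_∈_ to _∈ᴸ_)
open import Data.List.Membership.Propositional.Properties
  using (∈-∃++; ∈-++⁺ˡ; ∈-++⁺ʳ; ∈-++⁻; ∈-filter⁺; ∈-filter⁻; ∈-cartesianProduct⁺; ∈-allFin)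
open import Data.List.Properties using (length-++)
open import Data.List.Relation.Unary.All using (All; []; _∷_)
  renaming (lookup to All-lookup; map to All-map; tabulate to All-tabulate; zipWith to All-zipWith)
open import Data.List.Relation.Unary.All.Properties using (¬Any⇒All¬)
open import Data.List.Relation.Unary.AllPairs using (AllPairs; []; _∷_)
open import Data.List.Relation.Unary.Any using (Any; here; there) renaming (any? to anyᴸ?; map to Any-map)
open import Data.List.Relation.Unary.Any.Properties using (++⁺ˡ; ++⁺ʳ; ++⁻)
open import Data.Nat using (ℕ; zero; suc; _+_; _*_; _≤_; _<_; z≤n; s≤s; _≤?_; _<?_)
open import Data.Nat.Divisibility using (_∣_; divides)
open import Data.Nat.Induction using (<-wellFounded)
open import Data.Nat.Properties hiding (_≟_)
open import Algebra.Properties.CommutativeMonoid.Sum +-0-commutativeMonoid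
  using (sum; sum-init-last; ∑-distrib-+; sum-cong-≗)
open import Data.Product using (∃; ∃₂; _×_; _,_; proj₁; proj₂; uncurry)
open import Data.Sum using (_⊎_; inj₁; inj₂; [_,_]′)
open import Data.Vec using ([]; _∷_; tabulate) renaming (there to thereᵛ)
open import Data.Vec.Properties using (lookup⇒[]=; []=⇒lookup; lookup∘tabulate)
open import Function using (_∘_; id)
open import Function.Definitions using (Injective)
open import Induction.WellFounded using (Acc; acc)
open import Level using (0ℓ)
open import Relation.Binary.Construct.Closure.ReflexiveTransitive using (ε; _◅_; _◅◅_; reverse)
open import Relation.Binary.Definitions using (tri<; tri≈; tri>)
open import Relation.Binary.PropositionalEquality
open import Relation.Nullary using (¬_; Dec; yes; no; does; _×-dec_; _⊎-dec_; ¬?; contradiction)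
open import Relation.Nullary.Decidable using (decidable-stable; dec-true; dec-false)
open import Relation.Unary using (Pred; Decidable; _∪_; _≐_)

private variable
  n : ℕ

-- Subsets of a finite set and their cardinalities.

select : {P : Pred (Fin n) 0ℓ} → Decidable P → Subset n
select P? = tabulate (does ∘ P?)

∈-select⁺ : {P : Pred (Fin n) 0ℓ} (P? : Decidable P) → ∀ {x} → P x → x ∈ select P?
∈-select⁺ P? {x} px = lookup⇒[]= x _ (trans (lookup∘tabulate (does ∘ P?) x) (dec-true (P? x) px))

∈-select⁻ : {P : Pred (Fin n) 0ℓ} (P? : Decidable P) → ∀ {x} → x ∈ select P? → P x
∈-select⁻ {P = P} P? {x} x∈ = from (P? x) (trans (sym (lookup∘tabulate (does ∘ P?) x)) ([]=⇒lookup x∈))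
  where
  from : (d : Dec (P x)) → does d ≡ true → P x
  from (yes px) _ = px

∣∪∣+∣∩∣ : (p q : Subset n) → ∣ p ∪ˢ q ∣ + ∣ p ∩ q ∣ ≡ ∣ p ∣ + ∣ q ∣
∣∪∣+∣∩∣ [] [] = refl
∣∪∣+∣∩∣ (false ∷ p) (false ∷ q) = ∣∪∣+∣∩∣ p q
∣∪∣+∣∩∣ (false ∷ p) (true ∷ q) = trans (cong suc (∣∪∣+∣∩∣ p q)) (sym (+-suc ∣ p ∣ ∣ q ∣))
∣∪∣+∣∩∣ (true ∷ p) (false ∷ q) = cong suc (∣∪∣+∣∩∣ p q)
∣∪∣+∣∩∣ (true ∷ p) (true ∷ q) = cong suc (begin
  ∣ p ∪ˢ q ∣ + suc ∣ p ∩ q ∣  ≡⟨ +-suc _ _ ⟩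
  suc (∣ p ∪ˢ q ∣ + ∣ p ∩ q ∣) ≡⟨ cong suc (∣∪∣+∣∩∣ p q) ⟩
  suc (∣ p ∣ + ∣ q ∣)        ≡⟨ sym (+-suc _ _) ⟩
  ∣ p ∣ + suc ∣ q ∣          ∎)
  where open ≡-Reasoning

∣∪∣-disjoint : (p q : Subset n) → (∀ {x} → x ∈ p → x ∉ q) → ∣ p ∪ˢ q ∣ ≡ ∣ p ∣ + ∣ q ∣
∣∪∣-disjoint {n} p q disj = begin
  ∣ p ∪ˢ q ∣               ≡⟨ sym (+-identityʳ _) ⟩
  ∣ p ∪ˢ q ∣ + 0           ≡⟨ cong (∣ p ∪ˢ q ∣ +_) (sym ∣p∩q∣≡0) ⟩
  ∣ p ∪ˢ q ∣ + ∣ p ∩ q ∣   ≡⟨ ∣∪∣+∣∩∣ p q ⟩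
  ∣ p ∣ + ∣ q ∣           ∎
  where
  open ≡-Reasoning
  ∣p∩q∣≡0 : ∣ p ∩ q ∣ ≡ 0
  ∣p∩q∣≡0 = trans (cong ∣_∣ (Empty-unique λ (_ , x∈) → uncurry disj (x∈p∩q⁻ p q x∈))) (∣⊥∣≡0 n)

x∈p─q⇒x∉q : (p q : Subset n) → ∀ {x} → x ∈ p ─ q → x ∉ q
x∈p─q⇒x∉q (_ ∷ p) (true ∷ q) {suc x} (thereᵛ x∈) (thereᵛ x∈q) = x∈p─q⇒x∉q p q x∈ x∈q
x∈p─q⇒x∉q (_ ∷ p) (false ∷ q) {suc x} (thereᵛ x∈) (thereᵛ x∈q) = x∈p─q⇒x∉q p q x∈ x∈q

x∈p─q⁻ : (p q : Subset n) → ∀ {x} → x ∈ p ─ q → x ∈ p × x ∉ q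
x∈p─q⁻ p q x∈ = p─q⊆p p q x∈ , x∈p─q⇒x∉q p q x∈

x∈p-y⁻ : (p : Subset n) (y : Fin n) → ∀ {x} → x ∈ p - y → x ∈ p × x ≢ y
x∈p-y⁻ p y x∈ with x∈p─q⁻ p ⁅ y ⁆ x∈
... | x∈p , x∉y = x∈p , x∉⁅y⁆⇒x≢y x∉y

∣p∣≤∣p─q∣+∣p∩q∣ : (p q : Subset n) → ∣ p ∣ ≤ ∣ p ─ q ∣ + ∣ p ∩ q ∣
∣p∣≤∣p─q∣+∣p∩q∣ p q = ≤-trans (p⊆q⇒∣p∣≤∣q∣ cover) (≤-reflexive (∣∪∣-disjoint (p ─ q) (p ∩ q) disj))
  where
  cover : p ⊆ (p ─ q) ∪ˢ (p ∩ q)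
  cover {x} x∈p with x ∈? q
  ... | yes x∈q = x∈p∪q⁺ (inj₂ (x∈p∩q⁺ (x∈p , x∈q)))
  ... | no x∉q = x∈p∪q⁺ (inj₁ (x∈p∧x∉q⇒x∈p─q x∈p x∉q))
  disj : ∀ {x} → x ∈ p ─ q → x ∉ p ∩ q
  disj x∈ x∈′ = x∈p─q⇒x∉q p q x∈ (proj₂ (x∈p∩q⁻ p q x∈′))

∣p∣≤1+∣p-x∣ : (p : Subset n) (x : Fin n) → ∣ p ∣ ≤ suc ∣ p - x ∣
∣p∣≤1+∣p-x∣ p x = begin
  ∣ p ∣                        ≤⟨ ∣p∣≤∣p─q∣+∣p∩q∣ p ⁅ x ⁆ ⟩
  ∣ p - x ∣ + ∣ p ∩ ⁅ x ⁆ ∣    ≤⟨ +-monoʳ-≤ ∣ p - x ∣ (∣p∩q∣≤∣q∣ p ⁅ x ⁆) ⟩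
  ∣ p - x ∣ + ∣ ⁅ x ⁆ ∣        ≡⟨ cong (∣ p - x ∣ +_) (∣⁅x⁆∣≡1 x) ⟩
  ∣ p - x ∣ + 1                ≡⟨ +-comm _ 1 ⟩
  suc ∣ p - x ∣                ∎
  where open ≤-Reasoning

-- Edges as unordered pairs.

sameEdge-sym : ∀ {e f : Edge n} → SameEdge e f → SameEdge f e
sameEdge-sym (inj₁ (refl , refl)) = inj₁ (refl , refl)
sameEdge-sym (inj₂ (refl , refl)) = inj₂ (refl , refl)

sameEdge-trans : ∀ {e f g : Edge n} → SameEdge e f → SameEdge f g → SameEdge e g
sameEdge-trans (inj₁ (refl , refl)) s = s
sameEdge-trans (inj₂ (refl , refl)) (inj₁ (p , q)) = inj₂ (q , p)
sameEdge-trans (inj₂ (refl , refl)) (inj₂ (p , q)) = inj₁ (q , p)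

disjointEdges-sym : ∀ {e f : Edge n} → DisjointEdges e f → DisjointEdges f e
disjointEdges-sym ((ux , uy) , (vx , vy)) = (ux ∘ sym , vx ∘ sym) , (uy ∘ sym , vy ∘ sym)

disjointEdges? : (e f : Edge n) → Dec (DisjointEdges e f)
disjointEdges? (u , v) (x , y) =
  (¬? (u ≟ x) ×-dec ¬? (u ≟ y)) ×-dec (¬? (v ≟ x) ×-dec ¬? (v ≟ y))

commonVertex : (e f : Edge n) → ¬ DisjointEdges e f →
  ∃ λ x → ∃₂ λ y z → SameEdge e (x , y) × SameEdge f (x , z)
commonVertex (u , v) (x , y) meet with u ≟ x | u ≟ y | v ≟ x | v ≟ y
... | yes refl | _ | _ | _ = u , v , y , inj₁ (refl , refl) , inj₁ (refl , refl)
... | no _ | yes refl | _ | _ = u , v , x , inj₁ (refl , refl) , inj₂ (refl , refl)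
... | no _ | no _ | yes refl | _ = v , u , y , inj₂ (refl , refl) , inj₁ (refl , refl)
... | no _ | no _ | no _ | yes refl = v , u , x , inj₂ (refl , refl) , inj₂ (refl , refl)
... | no a | no b | no c | no d = ⊥-elim (meet ((a , b) , (c , d)))

-- Blending stable sets along a two-colouring.

Colouring : (Fin n → Bool) → (Fin n → Fin n → Set) → Set
Colouring c R = ∀ {u v} → R u v → c u ≢ c v

Stable : (Fin n → Fin n → Set) → Subset n → Set
Stable R S = ∀ {u v} → u ∈ S → v ∈ S → ¬ R u v

-- The lattice operations of stable sets of a bipartite graph: union on the
-- colour class b, intersection on the other one.
module _ (c : Fin n → Bool) (b : Bool) (S T : Subset n) where

  private
    P : Pred (Fin n) 0ℓ
    P v = (v ∈ S × v ∈ T) ⊎ (c v ≡ b × (v ∈ S ⊎ v ∈ T))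

    P? : Decidable P
    P? v = (v ∈? S ×-dec v ∈? T) ⊎-dec ((c v ≟ᵇ b) ×-dec (v ∈? S ⊎-dec v ∈? T))

  blend : Subset n
  blend = select P?

  blend⁺ : ∀ {v} → (v ∈ S × v ∈ T) ⊎ (c v ≡ b × (v ∈ S ⊎ v ∈ T)) → v ∈ blend
  blend⁺ = ∈-select⁺ P?

  blend-∪ : ∀ {v} → v ∈ blend → v ∈ S ⊎ v ∈ T
  blend-∪ v∈ with ∈-select⁻ P? v∈
  ... | inj₁ (v∈S , _) = inj₁ v∈S
  ... | inj₂ (_ , v∈) = v∈

  blend-∩ : ∀ {v} → v ∈ blend → c v ≢ b → v ∈ S × v ∈ T
  blend-∩ v∈ cv≢b with ∈-select⁻ P? v∈
  ... | inj₁ both = both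
  ... | inj₂ (cv≡b , _) = contradiction cv≡b cv≢b

-- A vertex of the union lies in the blend that unites its colour class, and the intersection lies
-- in both blends; inclusion-exclusion does the rest.
∣blend∣ : (c : Fin n → Bool) (b : Bool) (S T : Subset n) →
  ∣ S ∣ + ∣ T ∣ ≤ ∣ blend c b S T ∣ + ∣ blend c (not b) S T ∣
∣blend∣ c b S T = begin
  ∣ S ∣ + ∣ T ∣          ≡⟨ sym (∣∪∣+∣∩∣ S T) ⟩
  ∣ S ∪ˢ T ∣ + ∣ S ∩ T ∣  ≤⟨ +-mono-≤ (p⊆q⇒∣p∣≤∣q∣ union) (p⊆q⇒∣p∣≤∣q∣ inter) ⟩
  ∣ X ∪ˢ Y ∣ + ∣ X ∩ Y ∣  ≡⟨ ∣∪∣+∣∩∣ X Y ⟩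
  ∣ X ∣ + ∣ Y ∣          ∎
  where
  open ≤-Reasoning
  X = blend c b S T
  Y = blend c (not b) S T
  union : S ∪ˢ T ⊆ X ∪ˢ Y
  union {v} v∈ with c v ≟ᵇ b
  ... | yes eq = x∈p∪q⁺ (inj₁ (blend⁺ c b S T (inj₂ (eq , x∈p∪q⁻ S T v∈))))
  ... | no neq = x∈p∪q⁺ (inj₂ (blend⁺ c (not b) S T (inj₂ (¬-not neq , x∈p∪q⁻ S T v∈))))
  inter : S ∩ T ⊆ X ∩ Y
  inter v∈ = x∈p∩q⁺ (blend⁺ c b S T (inj₁ both) , blend⁺ c (not b) S T (inj₁ both))
    where both = x∈p∩q⁻ S T v∈

module _ {R : Fin n → Fin n → Set} (R-sym : ∀ {u v} → R u v → R v u)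
         (c : Fin n → Bool) (proper : Colouring c R)
         (S T : Subset n) {x y z : Fin n}
         (onlyˢ : ∀ {u v} → u ∈ S → v ∈ S → R u v → SameEdge (u , v) (x , y))
         (onlyᵗ : ∀ {u v} → u ∈ T → v ∈ T → R u v → SameEdge (u , v) (x , z))
         (cy : c y ≢ c x) (cz : c z ≢ c x) where

  private
    -- By symmetry, only edges directed from the colour of `x` to the other colour need be
    -- considered.
    orient : {Z : Fin n → Set} →
      (∀ {u v} → c u ≡ c x → c v ≢ c x → Z u → Z v → ¬ R u v) →
      ∀ {u v} → Z u → Z v → ¬ R u v
    orient ok {u} {v} zu zv r with c u ≟ᵇ c x
    ... | yes eq = ok eq (λ eq′ → proper r (trans eq (sym eq′))) zu zv r
    ... | no neq = ok (trans (¬-not (λ eq → proper r (sym eq))) (sym (¬-not (λ eq → neq (sym eq))))) neq zv zu (R-sym r)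

    endpoint : ∀ {u v w} → c u ≡ c x → c w ≢ c x → SameEdge (u , v) (x , w) → u ≡ x × v ≡ w
    endpoint eq neq (inj₁ s) = s
    endpoint eq neq (inj₂ (refl , _)) = contradiction eq neq

  -- The end not coloured like `x` lies in both sets and the other end in one of them. The edge is
  -- therefore xy inside `S` or xz inside `T`, which would put `y` into `T` or `z` into `S`.
  blend-stable : y ∉ T → z ∉ S → Stable R (blend c (c x) S T)
  blend-stable y∉T z∉S = orient {Z = _∈ blend c (c x) S T} ok
    where
    ok : ∀ {u v} → c u ≡ c x → c v ≢ c x → u ∈ blend c (c x) S T → v ∈ blend c (c x) S T → ¬ R u v
    ok eq neq u∈ v∈ r with blend-∩ c (c x) S T v∈ neq | blend-∪ c (c x) S T u∈
    ... | v∈S , v∈T | inj₁ u∈S with endpoint eq cy (onlyˢ u∈S v∈S r)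
    ...   | refl , refl = y∉T v∈T
    ok eq neq u∈ v∈ r | v∈S , v∈T | inj₂ u∈T with endpoint eq cz (onlyᵗ u∈T v∈T r)
    ...   | refl , refl = z∉S v∈S

  -- Here the end coloured like `x` lies in both sets, so the edge lies inside `S` or inside `T`.
  -- Its only candidates are xy and xz, and both lose their end `x`.
  blend-remove-stable : Stable R (blend c (not (c x)) S T - x)
  blend-remove-stable = orient {Z = _∈ Y - x} ok
    where
    Y = blend c (not (c x)) S T
    differs : ∀ {b b′ : Bool} → b ≡ b′ → b ≢ not b′
    differs {false} refl ()
    differs {true} refl ()
    ok : ∀ {u v} → c u ≡ c x → c v ≢ c x → u ∈ Y - x → v ∈ Y - x → ¬ R u v
    ok eq neq u∈ v∈ r with x∈p-y⁻ Y x u∈ | x∈p-y⁻ Y x v∈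
    ... | u∈Y , u≢x | v∈Y , _ with blend-∩ c _ S T u∈Y (differs eq) | blend-∪ c _ S T v∈Y
    ...   | u∈S , _ | inj₁ v∈S = u≢x (proj₁ (endpoint eq cy (onlyˢ u∈S v∈S r)))
    ...   | _ , u∈T | inj₂ v∈T = u≢x (proj₁ (endpoint eq cz (onlyᵗ u∈T v∈T r)))

-- König's theorem for lists of edges.

Linked : List (Edge n) → Fin n → Fin n → Set
Linked E u v = Any (SameEdge (u , v)) E

linked-sym : {E : List (Edge n)} → ∀ {u v} → Linked E u v → Linked E v u
linked-sym = Any-map (sameEdge-trans (inj₂ (refl , refl)))

-- `tight` is the hard half of König's theorem; the opposite inequality for graphs is
-- `independent+matching≤order`.
record KönigPair (E : List (Edge n)) (V : Subset n) : Set where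
  constructor könig
  field
    {S}      : Subset n
    {M}      : List (Edge n)
    S⊆V      : S ⊆ V
    stable   : Stable (Linked E) S
    M⊆E      : ∀ {e} → e ∈ᴸ M → e ∈ᴸ E
    disjoint : AllPairs DisjointEdges M
    tight    : ∣ V ∣ ≤ ∣ S ∣ + length M

-- Remove an edge e = xy, leaving a pair (S , M).  If S contains x and y and no
-- other edge meets e, move e to M and drop one end from S.  If f = xz meets e,
-- treat E − f in the same way to get (T , M′); when T contains x and z, the
-- two blends of S and T, the second one without x, are stable and have total
-- size at least |S| + |T| − 1, so one of them fits M or M′.
könig-list : (c : Fin n → Bool) (V : Subset n) (k : ℕ) (E : List (Edge n)) → length E ≤ k →
  Colouring c (Linked E) → KönigPair E V
könig-list c V k [] _ _ = könig id (λ _ _ ()) id [] (m≤m+n _ 0)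
könig-list {n} c V (suc k) (e@(p , q) ∷ E′) (s≤s len) proper
  with könig-list c V k E′ len (proper ∘ there)
... | könig {S} {M} S⊆V stable M⊆E disjoint tight
  with p ∈? S | q ∈? S
...   | no p∉S | _ = könig S⊆V stable⁺ (there ∘ M⊆E) disjoint tight
  where
  stable⁺ : Stable (Linked (e ∷ E′)) S
  stable⁺ u∈ v∈ (here (inj₁ (refl , refl))) = p∉S u∈
  stable⁺ u∈ v∈ (here (inj₂ (refl , refl))) = p∉S v∈
  stable⁺ u∈ v∈ (there r) = stable u∈ v∈ r
...   | yes _ | no q∉S = könig S⊆V stable⁺ (there ∘ M⊆E) disjoint tight
  where
  stable⁺ : Stable (Linked (e ∷ E′)) S
  stable⁺ u∈ v∈ (here (inj₁ (refl , refl))) = q∉S v∈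
  stable⁺ u∈ v∈ (here (inj₂ (refl , refl))) = q∉S u∈
  stable⁺ u∈ v∈ (there r) = stable u∈ v∈ r
...   | yes p∈S | yes q∈S with anyᴸ? (λ f → ¬? (disjointEdges? e f)) E′
...     | no none = könig (S⊆V ∘ p─q⊆p S ⁅ p ⁆) stable⁺ M⊆E⁺ (away ∷ disjoint) tight⁺
  where
  stable⁺ : Stable (Linked (e ∷ E′)) (S - p)
  stable⁺ u∈ v∈ (here (inj₁ (u≡p , _))) = proj₂ (x∈p-y⁻ S p u∈) u≡p
  stable⁺ u∈ v∈ (here (inj₂ (_ , v≡p))) = proj₂ (x∈p-y⁻ S p v∈) v≡p
  stable⁺ u∈ v∈ (there r) = stable (p─q⊆p S ⁅ p ⁆ u∈) (p─q⊆p S ⁅ p ⁆ v∈) r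
  M⊆E⁺ : ∀ {f} → f ∈ᴸ e ∷ M → f ∈ᴸ e ∷ E′
  M⊆E⁺ (here eq) = here eq
  M⊆E⁺ (there f∈) = there (M⊆E f∈)
  away : All (DisjointEdges e) M
  away = All-tabulate λ {f} f∈ →
    decidable-stable (disjointEdges? e f) (All-lookup (¬Any⇒All¬ E′ none) (M⊆E f∈))
  tight⁺ : ∣ V ∣ ≤ ∣ S - p ∣ + suc (length M)
  tight⁺ = begin
    ∣ V ∣                          ≤⟨ tight ⟩
    ∣ S ∣ + length M               ≤⟨ +-monoˡ-≤ (length M) (∣p∣≤1+∣p-x∣ S p) ⟩
    suc ∣ S - p ∣ + length M       ≡⟨ sym (+-suc _ _) ⟩
    ∣ S - p ∣ + suc (length M)     ∎
    where open ≤-Reasoning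
...     | yes some with find some
...       | f , f∈ , meet with ∈-∃++ f∈ | commonVertex e f meet
...         | E₁ , E₂ , refl | x , y , z , e≈xy , f≈xz
  -- The list without f is shorter but not structurally smaller, hence the recursion on the length
  -- bound `k`.
  with könig-list c V k (e ∷ E₁ ++ E₂)
         (≤-trans (≤-reflexive (trans (cong suc (length-++ E₁)) (trans (sym (+-suc (length E₁) _)) (sym (length-++ E₁ {f ∷ E₂}))))) len)
         (proper ∘ restore)
  where
  restore : ∀ {u v} → Linked (e ∷ E₁ ++ E₂) u v → Linked (e ∷ E₁ ++ f ∷ E₂) u v
  restore (here s) = here s
  restore (there r) with ++⁻ E₁ r
  ... | inj₁ r₁ = there (++⁺ˡ r₁)
  ... | inj₂ r₂ = there (++⁺ʳ E₁ (there r₂))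
... | könig {T} {M′} T⊆V stable′ M′⊆E disjoint′ tight′ = conclude
  where
  E = e ∷ E₁ ++ f ∷ E₂

  M′⊆E⁺ : ∀ {g} → g ∈ᴸ M′ → g ∈ᴸ E
  M′⊆E⁺ g∈ with M′⊆E g∈
  ... | here eq = here eq
  ... | there g∈′ with ∈-++⁻ E₁ g∈′
  ...   | inj₁ g∈₁ = there (∈-++⁺ˡ g∈₁)
  ...   | inj₂ g∈₂ = there (∈-++⁺ʳ E₁ (there g∈₂))

  e-linked : Linked E x y
  e-linked = here (sameEdge-sym e≈xy)
  f-linked′ : Linked (E₁ ++ f ∷ E₂) x z
  f-linked′ = ++⁺ʳ E₁ (here (sameEdge-sym f≈xz))

  onlyˢ : ∀ {u v} → u ∈ S → v ∈ S → Linked E u v → SameEdge (u , v) (x , y)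
  onlyˢ u∈ v∈ (here s) = sameEdge-trans s e≈xy
  onlyˢ u∈ v∈ (there r) = ⊥-elim (stable u∈ v∈ r)

  onlyᵗ : ∀ {u v} → u ∈ T → v ∈ T → Linked E u v → SameEdge (u , v) (x , z)
  onlyᵗ u∈ v∈ (here s) = ⊥-elim (stable′ u∈ v∈ (here s))
  onlyᵗ u∈ v∈ (there r) with ++⁻ E₁ r
  ... | inj₁ r₁ = ⊥-elim (stable′ u∈ v∈ (there (++⁺ˡ r₁)))
  ... | inj₂ (here s) = sameEdge-trans s f≈xz
  ... | inj₂ (there r₂) = ⊥-elim (stable′ u∈ v∈ (there (++⁺ʳ E₁ r₂)))

  ends : ∀ {a b} → SameEdge e (a , b) → a ∈ S × b ∈ S
  ends (inj₁ (refl , refl)) = p∈S , q∈S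
  ends (inj₂ (refl , refl)) = q∈S , p∈S

  X Y : Subset n
  X = blend c (c x) S T
  Y = blend c (not (c x)) S T

  blend⊆V : ∀ b → blend c b S T ⊆ V
  blend⊆V b v∈ = [ S⊆V , T⊆V ]′ (blend-∪ c b S T v∈)

  conclude : KönigPair E V
  conclude with x ∈? T | z ∈? T
  ... | no x∉T | _ = könig T⊆V (λ u∈ v∈ r → x∉T (x∈ u∈ v∈ (onlyᵗ u∈ v∈ r))) M′⊆E⁺ disjoint′ tight′
    where
    x∈ : ∀ {u v} → u ∈ T → v ∈ T → SameEdge (u , v) (x , z) → x ∈ T
    x∈ u∈ v∈ (inj₁ (refl , _)) = u∈
    x∈ u∈ v∈ (inj₂ (_ , refl)) = v∈
  ... | yes _ | no z∉T = könig T⊆V (λ u∈ v∈ r → z∉T (z∈ u∈ v∈ (onlyᵗ u∈ v∈ r))) M′⊆E⁺ disjoint′ tight′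
    where
    z∈ : ∀ {u v} → u ∈ T → v ∈ T → SameEdge (u , v) (x , z) → z ∈ T
    z∈ u∈ v∈ (inj₁ (_ , refl)) = v∈
    z∈ u∈ v∈ (inj₂ (refl , _)) = u∈
  ... | yes x∈T | yes z∈T with ∣ S ∣ ≤? ∣ X ∣
  ...   | yes ∣S∣≤∣X∣ = könig (blend⊆V (c x))
            (blend-stable linked-sym c proper S T onlyˢ onlyᵗ
              (proper (linked-sym e-linked)) (proper (linked-sym (there f-linked′))) y∉T z∉S)
            (there ∘ M⊆E) disjoint (≤-trans tight (+-monoˡ-≤ (length M) ∣S∣≤∣X∣))
    where
    -- The list for `T` still contains e, and the list for `S` still contains f.
    y∉T : y ∉ T
    y∉T y∈T = stable′ x∈T y∈T (here (sameEdge-sym e≈xy))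
    z∉S : z ∉ S
    z∉S z∈S = stable (proj₁ (ends e≈xy)) z∈S f-linked′
  ...   | no ∣S∣≰∣X∣ = könig (blend⊆V (not (c x)) ∘ p─q⊆p Y ⁅ x ⁆)
            (blend-remove-stable linked-sym c proper S T onlyˢ onlyᵗ
              (proper (linked-sym e-linked)) (proper (linked-sym (there f-linked′))))
            M′⊆E⁺ disjoint′ (≤-trans tight′ (+-monoˡ-≤ (length M′) ∣T∣≤))
    where
    -- The strict inequality between the sizes of `X` and `S` pays for the vertex `x` removed from
    -- `Y`.
    ∣T∣≤ : ∣ T ∣ ≤ ∣ Y - x ∣
    ∣T∣≤ = ≤-pred (+-cancelˡ-≤ ∣ X ∣ _ _ (begin
      ∣ X ∣ + suc ∣ T ∣      ≡⟨ +-suc _ _ ⟩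
      suc ∣ X ∣ + ∣ T ∣      ≤⟨ +-monoˡ-≤ ∣ T ∣ (≰⇒> ∣S∣≰∣X∣) ⟩
      ∣ S ∣ + ∣ T ∣          ≤⟨ ∣blend∣ c (c x) S T ⟩
      ∣ X ∣ + ∣ Y ∣          ≤⟨ +-monoʳ-≤ ∣ X ∣ (∣p∣≤1+∣p-x∣ Y x) ⟩
      ∣ X ∣ + suc ∣ Y - x ∣  ∎))
      where open ≤-Reasoning

-- Weak duality between independent sets and matchings.

∣V─T∣+∣T∣≤∣V∣ : {V T : Subset n} → T ⊆ V → ∣ V ─ T ∣ + ∣ T ∣ ≤ ∣ V ∣
∣V─T∣+∣T∣≤∣V∣ {V = V} {T} T⊆V = begin
  ∣ V ─ T ∣ + ∣ T ∣  ≡⟨ sym (∣∪∣-disjoint (V ─ T) T (x∈p─q⇒x∉q V T)) ⟩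
  ∣ (V ─ T) ∪ˢ T ∣    ≤⟨ p⊆q⇒∣p∣≤∣q∣ ([ p─q⊆p V T , T⊆V ]′ ∘ x∈p∪q⁻ (V ─ T) T) ⟩
  ∣ V ∣              ∎
  where open ≤-Reasoning

Hits : Subset n → Edge n → Set
Hits U (u , v) = u ∈ U ⊎ v ∈ U

-- Each edge uses up a vertex of `U` of its own: the edges disjoint from it are still hit once that
-- vertex is removed.
length≤∣cover∣ : (U : Subset n) {L : List (Edge n)} → AllPairs DisjointEdges L → All (Hits U) L →
  length L ≤ ∣ U ∣
length≤∣cover∣ U [] [] = z≤n
length≤∣cover∣ {n} U {(u , v) ∷ L} (away ∷ disjoint) (hit ∷ hits) = [ via u left , via v right ]′ hit
  where
  via : ∀ x → (∀ {f} → DisjointEdges (u , v) f → x ≢ proj₁ f × x ≢ proj₂ f) → x ∈ U → suc (length L) ≤ ∣ U ∣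
  via x avoid x∈U = ≤-trans
    (s≤s (length≤∣cover∣ (U - x) disjoint (All-zipWith keep (away , hits))))
    (x∈p⇒∣p-x∣<∣p∣ x∈U)
    where
    keep : ∀ {f} → DisjointEdges (u , v) f × Hits U f → Hits (U - x) f
    keep (d , inj₁ a∈) = inj₁ (x∈p∧x≢y⇒x∈p-y a∈ (proj₁ (avoid d) ∘ sym))
    keep (d , inj₂ b∈) = inj₂ (x∈p∧x≢y⇒x∈p-y b∈ (proj₂ (avoid d) ∘ sym))
  left : ∀ {f} → DisjointEdges (u , v) f → u ≢ proj₁ f × u ≢ proj₂ f
  left = proj₁
  right : ∀ {f} → DisjointEdges (u , v) f → v ≢ proj₁ f × v ≢ proj₂ f
  right = proj₂

equal-or-disjoint : {L : List (Edge n)} → AllPairs DisjointEdges L → ∀ {e f} → e ∈ᴸ L → f ∈ᴸ L →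
  e ≡ f ⊎ DisjointEdges e f
equal-or-disjoint _ (here refl) (here refl) = inj₁ refl
equal-or-disjoint (away ∷ _) (here refl) (there f∈) = inj₂ (All-lookup away f∈)
equal-or-disjoint (away ∷ _) (there e∈) (here refl) = inj₂ (disjointEdges-sym (All-lookup away e∈))
equal-or-disjoint (_ ∷ disjoint) (there e∈) (there f∈) = equal-or-disjoint disjoint e∈ f∈

module _ (G : Graph n) where

  matching-hits : ∀ {T L} → Independent G T → Matching G L → All (Hits (V G ─ T)) L
  matching-hits {T} {L} (_ , indep) (edges , _) = All-tabulate λ {f} f∈ → hit f (All-lookup edges f∈)
    where
    hit : ∀ f → uncurry (Adj G) f → Hits (V G ─ T) f
    hit (u , v) uv with u ∈? T
    ... | no u∉T = inj₁ (x∈p∧x∉q⇒x∈p─q (adj⇒∈V G uv) u∉T)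
    ... | yes u∈T = inj₂ (x∈p∧x∉q⇒x∈p─q (adj⇒∈V G (adj-sym G uv)) (λ v∈T → indep u∈T v∈T uv))

  independent+matching≤order : ∀ {T L} → Independent G T → Matching G L → ∣ T ∣ + length L ≤ order G
  independent+matching≤order {T} {L} indep match = begin
    ∣ T ∣ + length L      ≤⟨ +-monoʳ-≤ ∣ T ∣ (length≤∣cover∣ _ (proj₂ match) (matching-hits indep match)) ⟩
    ∣ T ∣ + ∣ V G ─ T ∣   ≡⟨ +-comm ∣ T ∣ _ ⟩
    ∣ V G ─ T ∣ + ∣ T ∣   ≤⟨ ∣V─T∣+∣T∣≤∣V∣ (proj₁ indep) ⟩
    order G               ∎
    where open ≤-Reasoning

  -- By weak duality, a pair that reaches the order is optimal in both components.
  certificate⇒KönigEgerváry : ∀ {S M} → Independent G S → Matching G M →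
    order G ≤ ∣ S ∣ + length M → KönigEgerváry G
  certificate⇒KönigEgerváry {S} {M} indep match tight =
    _ , _ ,
    (S , (indep , λ T indepT → +-cancelʳ-≤ (length M) _ _
      (≤-trans (independent+matching≤order indepT match) tight)) , refl) ,
    (M , (match , λ L matchL → +-cancelˡ-≤ ∣ S ∣ _ _
      (≤-trans (independent+matching≤order indep matchL) tight)) , refl) ,
    ≤-antisym (independent+matching≤order indep match) tight

  module _ {S M} (indep : Independent G S) (match : Matching G M)
           (tight : order G ≤ ∣ S ∣ + length M) {v} (v∈V : v ∈ V G) (v∉S : v ∉ S) where

    private
      U : Subset n
      U = V G ─ S

      -- Tightness makes the complement of `S` a cover of `M` with no vertex to spare.
      ¬hits : ¬ All (Hits (U - v)) M
      ¬hits hits = <⇒≱ (begin-strict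
        ∣ S ∣ + length M      ≤⟨ +-monoʳ-≤ ∣ S ∣ (length≤∣cover∣ _ (proj₂ match) hits) ⟩
        ∣ S ∣ + ∣ U - v ∣     <⟨ +-monoʳ-< ∣ S ∣ (x∈p⇒∣p-x∣<∣p∣ (x∈p∧x∉q⇒x∈p─q v∈V v∉S)) ⟩
        ∣ S ∣ + ∣ U ∣         ≡⟨ +-comm ∣ S ∣ _ ⟩
        ∣ U ∣ + ∣ S ∣         ≤⟨ ∣V─T∣+∣T∣≤∣V∣ (proj₁ indep) ⟩
        order G               ∎) tight
        where open ≤-Reasoning

    -- If no edge of `M` contained `v`, every edge would keep its hit after the removal of `v` from
    -- `U`.
    covered : ¬ (∀ u → ¬ Linked M v u)
    covered uncovered = ¬hits (All-tabulate λ {f} f∈ → hit f f∈ (All-lookup (matching-hits indep match) f∈))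
      where
      hit : ∀ f → f ∈ᴸ M → Hits U f → Hits (U - v) f
      hit (x , y) f∈ (inj₁ x∈) = inj₁ (x∈p∧x≢y⇒x∈p-y x∈ λ { refl → uncovered y (lose f∈ (inj₁ (refl , refl))) })
      hit (x , y) f∈ (inj₂ y∈) = inj₂ (x∈p∧x≢y⇒x∈p-y y∈ λ { refl → uncovered x (lose f∈ (inj₂ (refl , refl))) })

    -- Were `u` outside `S`, it would hit the edge vu in place of `v`, while the other edges of `M`
    -- avoid `v`; so `U - v` would still cover `M`.
    partner∈ : ∀ {u} → Linked M v u → u ∈ S
    partner∈ {u} link with find link
    ... | e , e∈ , vu≈e = decidable-stable (u ∈? S) λ u∉S → ¬hits (All-tabulate λ {f} f∈ →
            hit u∉S vu≈e (equal-or-disjoint (proj₂ match) e∈ f∈) (All-lookup (matching-hits indep match) f∈))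
      where
      avoids : ∀ {e f} → SameEdge (v , u) e → DisjointEdges e f → v ≢ proj₁ f × v ≢ proj₂ f
      avoids (inj₁ (refl , refl)) (d , _) = d
      avoids (inj₂ (refl , refl)) (_ , d) = d
      adj : ∀ {e} → SameEdge (v , u) e → uncurry (Adj G) e → Adj G u v
      adj (inj₁ (refl , refl)) a = adj-sym G a
      adj (inj₂ (refl , refl)) a = a
      uv : Adj G u v
      uv = adj vu≈e (All-lookup (proj₁ match) e∈)
      u∈ : u ∉ S → u ∈ U - v
      u∈ u∉S = x∈p∧x≢y⇒x∈p-y (x∈p∧x∉q⇒x∈p─q (adj⇒∈V G uv) u∉S) λ eq → adj-irr G eq uv
      hit : u ∉ S → ∀ {e f} → SameEdge (v , u) e → e ≡ f ⊎ DisjointEdges e f → Hits U f → Hits (U - v) f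
      hit u∉S (inj₁ (refl , refl)) (inj₁ refl) _ = inj₂ (u∈ u∉S)
      hit u∉S (inj₂ (refl , refl)) (inj₁ refl) _ = inj₁ (u∈ u∉S)
      hit u∉S s (inj₂ d) (inj₁ x∈) = inj₁ (x∈p∧x≢y⇒x∈p-y x∈ (proj₁ (avoids s d) ∘ sym))
      hit u∉S s (inj₂ d) (inj₂ x∈) = inj₂ (x∈p∧x≢y⇒x∈p-y x∈ (proj₂ (avoids s d) ∘ sym))

  opaque
    bipartite-könig : (c : Fin n → Bool) → Colouring c (Adj G) →
      ∃₂ λ S M → Independent G S × Matching G M × order G ≤ ∣ S ∣ + length M
    bipartite-könig c proper = S , M , (S⊆V , λ u∈ v∈ uv → stable u∈ v∈ (linked uv)) ,
        (All-tabulate (λ f∈ → proj₂ (∈-filter⁻ (uncurry (adj? G)) {xs = pairs} (M⊆E f∈))) , disjoint) , tight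
      where
      pairs E : List (Edge n)
      pairs = cartesianProduct (allFin n) (allFin n)
      -- Every edge is listed in both orientations; pairwise disjointness prevents `M` from using
      -- both.
      E = filter (uncurry (adj? G)) pairs
      linked : ∀ {u v} → Adj G u v → Linked E u v
      linked {u} {v} uv = lose (∈-filter⁺ (uncurry (adj? G)) (∈-cartesianProduct⁺ (∈-allFin u) (∈-allFin v)) uv)
                               (inj₁ (refl , refl))
      unlinked : ∀ {u v} → Linked E u v → Adj G u v
      unlinked r with find r
      ... | f , f∈ , s with ∈-filter⁻ (uncurry (adj? G)) {xs = pairs} f∈ | s
      ...   | _ , a | inj₁ (refl , refl) = a
      ...   | _ , a | inj₂ (refl , refl) = adj-sym G a
      open KönigPair (könig-list c (V G) (length E) E ≤-refl (proper ∘ unlinked))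

-- Odd closed walks, odd cycles and two-colourings.

par : ℕ → Bool
par zero = false
par (suc k) = not (par k)

par-+ : ∀ a b → par (a + b) ≡ par a xor par b
par-+ zero b = refl
par-+ (suc a) b = trans (cong not (par-+ a b)) (not-distribˡ-xor (par a) (par b))

2∣⇒par : ∀ {k} → 2 ∣ k → par k ≡ false
2∣⇒par (divides zero refl) = refl
2∣⇒par (divides (suc q) refl) = trans (not-involutive _) (2∣⇒par (divides q refl))

module _ (G : Graph n) where

  -- Time runs over all natural numbers, constrained only up to `L`, so that cutting walks needs
  -- arithmetic but no index casts.
  record ClosedWalk (L : ℕ) : Set where
    field
      at     : ℕ → Fin n
      step   : ∀ {i} → i < L → Adj G (at i) (at (suc i))
      closed : at 0 ≡ at L

  open ClosedWalk

  segment : ∀ {L} (w : ClosedWalk L) a d → a + d ≤ L → at w a ≡ at w (a + d) → ClosedWalk d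
  segment w a d a+d≤L eq = record
    { at = λ t → at w (a + t)
    ; step = λ {t} t<d → subst (Adj G (at w (a + t)) ∘ at w) (sym (+-suc a t))
                           (step w (<-≤-trans (+-monoʳ-< a t<d) a+d≤L))
    ; closed = trans (cong (at w) (+-identityʳ a)) eq
    }

  -- The closed piece between the times `a` and `a + d` is cut out; by `eq`, the two halves of `at′`
  -- agree at time `a`.
  shortcut : ∀ a d r (w : ClosedWalk (a + d + r)) → at w a ≡ at w (a + d) → ClosedWalk (a + r)
  shortcut a d r w eq = record { at = at′ ; step = step′ ; closed = closed′ }
    where
    at′ : ℕ → Fin n
    at′ t with t ≤? a
    ... | yes _ = at w t
    ... | no _ = at w (t + d)
    low : ∀ {t} → t ≤ a → at′ t ≡ at w t
    low {t} t≤a with t ≤? a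
    ... | yes _ = refl
    ... | no t≰a = contradiction t≤a t≰a
    high : ∀ {t} → a ≤ t → at′ t ≡ at w (t + d)
    high {t} a≤t with t ≤? a
    ... | no _ = refl
    ... | yes t≤a with ≤-antisym t≤a a≤t
    ...   | refl = eq
    swap-+ : a + r + d ≡ a + d + r
    swap-+ = trans (+-assoc a r d) (trans (cong (a +_) (+-comm r d)) (sym (+-assoc a d r)))
    step′ : ∀ {t} → t < a + r → Adj G (at′ t) (at′ (suc t))
    step′ {t} t< with ≤-<-connex a t
    ... | inj₂ t<a = subst₂ (Adj G) (sym (low (<⇒≤ t<a))) (sym (low t<a))
                      (step w (<-≤-trans t<a (≤-trans (m≤m+n a d) (m≤m+n (a + d) r))))
    ... | inj₁ a≤t = subst₂ (Adj G) (sym (high a≤t)) (sym (high (m≤n⇒m≤1+n a≤t)))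
                      (step w (subst (t + d <_) swap-+ (+-monoˡ-< d t<)))
    closed′ : at′ 0 ≡ at′ (a + r)
    closed′ = trans (low z≤n) (trans (closed w) (sym (trans (high (m≤m+n a r)) (cong (at w) swap-+))))

  simpleWalk⇒cycle : ∀ {L} (w : ClosedWalk L) → par L ≡ true →
    (∀ {i j} → i < j → j < L → at w i ≢ at w j) → ∃ λ (C : Cycle G) → Odd C
  simpleWalk⇒cycle {L} w odd norep = record
    { len = L
    ; vertex = at w ∘ toℕ
    ; nontrivial = positive odd
    ; walk = λ i → subst (λ t → Adj G (at w t) (at w (suc (toℕ i)))) (sym (toℕ-inject₁ i)) (step w (toℕ<n i))
    ; trail = λ i j same → toℕ-injective (trail′ (toℕ<n i) (toℕ<n j)
        (subst₂ (λ s t → SameEdge (at w s , at w (suc (toℕ i))) (at w t , at w (suc (toℕ j))))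
          (toℕ-inject₁ i) (toℕ-inject₁ j) same))
    ; closed = trans (closed w) (cong (at w) (sym (toℕ-fromℕ L)))
    ; simple = λ {i} {j} eq → toℕ-injective (inj (toℕ<n i) (toℕ<n j)
        (subst₂ (λ s t → at w s ≡ at w t) (toℕ-inject₁ i) (toℕ-inject₁ j) eq))
    } , λ even → contradiction (trans (sym odd) (2∣⇒par even)) λ ()
    where
    positive : ∀ {k} → par k ≡ true → 0 < k
    positive {suc k} _ = s≤s z≤n
    inj : ∀ {i j} → i < L → j < L → at w i ≡ at w j → i ≡ j
    inj {i} {j} i<L j<L eq with <-cmp i j
    ... | tri< i<j _ _ = contradiction eq (norep i<j j<L)
    ... | tri≈ _ i≡j _ = i≡j
    ... | tri> _ _ j<i = contradiction (sym eq) (norep j<i i<L)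
    -- If the edge `j` is the last one and is traversed against the edge `i`, then `i` is 0 and `j`
    -- is 1, so `L` is the even number 2.
    wrap : ∀ {i j} → suc i < L → suc j ≡ L → at w i ≡ at w (suc j) → at w (suc i) ≡ at w j → ⊥
    wrap {i} {j} i+1<L refl eq eq′ with inj (<-trans (n<1+n i) i+1<L) (s≤s z≤n) (trans eq (sym (closed w)))
    ... | refl with inj i+1<L (n<1+n j) eq′
    ...   | refl = contradiction odd λ ()
    trail′ : ∀ {i j} → i < L → j < L → SameEdge (at w i , at w (suc i)) (at w j , at w (suc j)) → i ≡ j
    trail′ i<L j<L (inj₁ (eq , _)) = inj i<L j<L eq
    trail′ {i} {j} i<L j<L (inj₂ (eq , eq′)) with m≤n⇒m<n∨m≡n i<L | m≤n⇒m<n∨m≡n j<L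
    ... | inj₁ i+1<L | inj₁ j+1<L with inj i<L j+1<L eq | inj i+1<L j<L eq′
    ...   | refl | eq″ = contradiction eq″ (<⇒≢ (m<n⇒m<1+n (n<1+n j)) ∘ sym)
    trail′ i<L j<L (inj₂ (eq , eq′)) | inj₁ i+1<L | inj₂ j+1≡L = ⊥-elim (wrap i+1<L j+1≡L eq eq′)
    trail′ i<L j<L (inj₂ (eq , eq′)) | inj₂ i+1≡L | inj₁ j+1<L = ⊥-elim (wrap j+1<L i+1≡L (sym eq′) (sym eq))
    trail′ i<L j<L (inj₂ (eq , eq′)) | inj₂ i+1≡L | inj₂ j+1≡L = suc-injective (trans i+1≡L (sym j+1≡L))

  -- A repeated vertex splits an odd closed walk into two shorter closed walks,
  -- one of which is odd.
  oddWalk⇒oddCycle : ∀ {L} → Acc _<_ L → (w : ClosedWalk L) → par L ≡ true → ∃ λ (C : Cycle G) → Odd C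
  oddWalk⇒oddCycle {L} (acc rec) w odd
    with any? {n = L} (λ i → any? {n = L} (λ j → (toℕ i <? toℕ j) ×-dec (at w (toℕ i) ≟ at w (toℕ j))))
  ... | no none = simpleWalk⇒cycle w odd λ {i} {j} i<j j<L eq →
    none (fromℕ< (<-trans i<j j<L) , fromℕ< j<L ,
      subst₂ _<_ (sym (toℕ-fromℕ< _)) (sym (toℕ-fromℕ< _)) i<j ,
      subst₂ (λ s t → at w s ≡ at w t) (sym (toℕ-fromℕ< _)) (sym (toℕ-fromℕ< _)) eq)
  ... | yes (i , j , i<j , eq) = split (toℕ i) (m≤n⇒∃[o]m+o≡n (<⇒≤ i<j)) (m≤n⇒∃[o]m+o≡n (<⇒≤ (toℕ<n j))) i<j (toℕ<n j) eq
    where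
    split : ∀ a {b} → (∃ λ d → a + d ≡ b) → (∃ λ r → b + r ≡ L) → a < b → b < L → at w a ≡ at w b →
            ∃ λ (C : Cycle G) → Odd C
    split a (d , refl) (r , refl) a<b b<L eq with par d in d-odd
    ... | true = oddWalk⇒oddCycle (rec (≤-<-trans (m≤n+m d a) b<L)) (segment w a d (<⇒≤ b<L) eq) d-odd
    ... | false = oddWalk⇒oddCycle (rec (+-monoˡ-< r a<b)) (shortcut a d r w eq) odd′
      where
      odd′ : par (a + r) ≡ true
      odd′ = begin
        par (a + r)                     ≡⟨ par-+ a r ⟩
        par a xor par r                 ≡⟨ cong (_xor par r) (sym (xor-identityʳ (par a))) ⟩
        (par a xor false) xor par r     ≡⟨ cong (λ b → (par a xor b) xor par r) (sym d-odd) ⟩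
        (par a xor par d) xor par r     ≡⟨ cong (_xor par r) (sym (par-+ a d)) ⟩
        par (a + d) xor par r           ≡⟨ sym (par-+ (a + d) r) ⟩
        par (a + d + r)                 ≡⟨ odd ⟩
        true                            ∎
        where open ≡-Reasoning

  star-length : ∀ {u v} → Reachable G u v → ℕ
  star-length ε = 0
  star-length (_ ◅ p) = suc (star-length p)

  star-at : ∀ {u v} → Reachable G u v → ℕ → Fin n
  star-at {u} ε _ = u
  star-at {u} (_ ◅ _) zero = u
  star-at (_ ◅ p) (suc t) = star-at p t

  star-at-start : ∀ {u v} (p : Reachable G u v) → star-at p 0 ≡ u
  star-at-start ε = refl
  star-at-start (_ ◅ _) = refl

  star-at-end : ∀ {u v} (p : Reachable G u v) → star-at p (star-length p) ≡ v
  star-at-end ε = refl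
  star-at-end (_ ◅ p) = star-at-end p

  star-step : ∀ {u v} (p : Reachable G u v) → ∀ {t} → t < star-length p → Adj G (star-at p t) (star-at p (suc t))
  star-step (_◅_ {u} a p) {zero} _ = subst (Adj G u) (sym (star-at-start p)) a
  star-step (_ ◅ p) {suc t} (s≤s t<) = star-step p t<

  star-length-◅◅ : ∀ {u v w} (p : Reachable G u v) (q : Reachable G v w) →
    star-length (p ◅◅ q) ≡ star-length p + star-length q
  star-length-◅◅ ε q = refl
  star-length-◅◅ (_ ◅ p) q = cong suc (star-length-◅◅ p q)

  closedStar : ∀ {u} (p : Reachable G u u) → ClosedWalk (star-length p)
  closedStar p = record { at = star-at p ; step = star-step p ; closed = trans (star-at-start p) (sym (star-at-end p)) }

  private
    reach : Fin n → Subset n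
    reach v = proj₁ (reachableSet G v)

  reach⁻ : ∀ {u v} → v ∈ reach u → Reachable G u v
  reach⁻ {u} = proj₁ (proj₂ (reachableSet G u))

  reach⁺ : ∀ {u v} → Reachable G u v → v ∈ reach u
  reach⁺ {u} = proj₂ (proj₂ (reachableSet G u))

  private
    reach-cong : ∀ {u v} → Adj G u v → reach u ≡ reach v
    reach-cong uv = ⊆-antisym (λ x∈ → reach⁺ (adj-sym G uv ◅ reach⁻ x∈)) (λ x∈ → reach⁺ (uv ◅ reach⁻ x∈))

    -- The representative of a component depends on its vertex set only.
    pick : ∀ {p : Subset n} → Fin n → Dec (Nonempty p) → Fin n
    pick _ (yes (x , _)) = x
    pick d (no _) = d

    root : Fin n → Fin n
    root v = pick v (nonempty? (reach v))

    root-cong : ∀ {u v} → Adj G u v → root u ≡ root v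
    root-cong {u} {v} uv = go (reach-cong uv) (reach⁺ {u} ε)
      where
      go : ∀ {p q} → p ≡ q → u ∈ p → pick u (nonempty? p) ≡ pick v (nonempty? q)
      go {p} refl u∈p with nonempty? p
      ... | yes _ = refl
      ... | no empty = contradiction (u , u∈p) empty

    toRoot : ∀ v → Reachable G v (root v)
    toRoot v = go (nonempty? (reach v))
      where
      go : (d : Dec (Nonempty (reach v))) → Reachable G v (pick v d)
      go (yes (_ , x∈)) = reach⁻ x∈
      go (no empty) = contradiction (v , reach⁺ {v} ε) empty

    fromRoot : ∀ v → ∃ λ (p : Reachable G (root v) v) → star-length p ≡ star-length (toRoot v)
    fromRoot v = go (toRoot v)
      where
      go : ∀ {u w} (p : Reachable G u w) → ∃ λ (q : Reachable G w u) → star-length q ≡ star-length p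
      go ε = ε , refl
      go (a ◅ p) with go p
      ... | q , eq = q ◅◅ (adj-sym G a ◅ ε) , trans (star-length-◅◅ q _) (trans (+-comm _ 1) (cong suc eq))

  -- Colour a vertex by the parity of a walk to the representative of its component.
  opaque
    no-oddCycle⇒bipartite : (∀ (C : Cycle G) → ¬ Odd C) → ∃ λ c → Colouring c (Adj G)
    no-oddCycle⇒bipartite none = colour , proper
      where
      colour : Fin n → Bool
      colour v = par (star-length (toRoot v))
      -- Equal colours at the ends of uv would make the closed walk from v to u, on to the root and
      -- back to v odd.
      proper : Colouring colour (Adj G)
      proper {u} {v} uv same with fromRoot v
      ... | back , back-length = uncurry none (oddWalk⇒oddCycle (<-wellFounded _) (closedStar loop) odd)
        where
        there′ : Reachable G v (root u)
        there′ = adj-sym G uv ◅ toRoot u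
        back′ : Reachable G (root u) v
        back′ = subst (λ r → Reachable G r v) (sym (root-cong uv)) back
        back′-length : star-length back′ ≡ star-length (toRoot v)
        back′-length = trans (subst-length (sym (root-cong uv))) back-length
          where
          subst-length : ∀ {r} (eq : root v ≡ r) → star-length (subst (λ r → Reachable G r v) eq back) ≡ star-length back
          subst-length refl = refl
        loop : Reachable G v v
        loop = there′ ◅◅ back′
        odd : par (star-length loop) ≡ true
        odd = begin
          par (star-length loop)                          ≡⟨ cong par (star-length-◅◅ there′ back′) ⟩
          not (par (star-length (toRoot u) + star-length back′)) ≡⟨ cong not (par-+ (star-length (toRoot u)) _) ⟩
          not (colour u xor par (star-length back′))      ≡⟨ cong (λ k → not (colour u xor par k)) back′-length ⟩
          not (colour u xor colour v)                     ≡⟨ cong (λ b → not (b xor colour v)) same ⟩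
          not (colour v xor colour v)                     ≡⟨ cong not (xor-same (colour v)) ⟩
          true                                            ∎
          where open ≡-Reasoning

-- Counting along a closed sequence of vertices.

sum-≤ : ∀ {ℓ} (f : Fin ℓ → ℕ) → (∀ i → f i ≤ 1) → sum f ≤ ℓ
sum-≤ {zero} f f≤1 = z≤n
sum-≤ {suc ℓ} f f≤1 = +-mono-≤ (f≤1 zero) (sum-≤ (f ∘ suc) (f≤1 ∘ suc))

sum-≥ : ∀ {ℓ} (f : Fin ℓ → ℕ) → (∀ i → 1 ≤ f i) → ℓ ≤ sum f
sum-≥ {zero} f 1≤f = z≤n
sum-≥ {suc ℓ} f 1≤f = +-mono-≤ (1≤f zero) (sum-≥ (f ∘ suc) (1≤f ∘ suc))

sum-≥-except : ∀ {ℓ} (f : Fin ℓ → ℕ) m → (∀ i → i ≢ m → 1 ≤ f i) → ℓ ≤ suc (sum f)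
sum-≥-except {suc ℓ} f zero 1≤f =
  s≤s (≤-trans (sum-≥ (f ∘ suc) (λ i → 1≤f (suc i) λ ())) (m≤n+m _ (f zero)))
sum-≥-except {suc ℓ} f (suc m) 1≤f =
  ≤-trans (+-mono-≤ (1≤f zero λ ()) (sum-≥-except (f ∘ suc) m λ i i≢m → 1≤f (suc i) (i≢m ∘ fsuc-injective)))
          (≤-reflexive (+-suc (f zero) _))

-- In a closed sequence each vertex begins one step and ends one step, so it is counted twice.
sum-edges : ∀ {ℓ} (g : Fin (suc ℓ) → ℕ) → g zero ≡ g (fromℕ ℓ) →
  sum (λ i → g (inject₁ i) + g (suc i)) ≡ sum (g ∘ inject₁) * 2
sum-edges {ℓ} g eq = begin
  sum (λ i → g (inject₁ i) + g (suc i))   ≡⟨ ∑-distrib-+ (g ∘ inject₁) (g ∘ suc) ⟩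
  s + sum (g ∘ suc)                       ≡⟨ cong (s +_) (+-cancelˡ-≡ (g zero) _ _ rotate) ⟩
  s + s                                   ≡⟨ cong (s +_) (sym (+-identityʳ s)) ⟩
  2 * s                                   ≡⟨ *-comm 2 s ⟩
  s * 2                                   ∎
  where
  open ≡-Reasoning
  s = sum (g ∘ inject₁)
  rotate : g zero + sum (g ∘ suc) ≡ g zero + s
  rotate = begin
    sum g                  ≡⟨ sum-init-last g ⟩
    s + g (fromℕ ℓ)        ≡⟨ cong (s +_) (sym eq) ⟩
    s + g zero             ≡⟨ +-comm s _ ⟩
    g zero + s             ∎

χ : Subset n → Fin n → ℕ
χ p v = if does (v ∈? p) then 1 else 0

χ-∈ : {p : Subset n} {v : Fin n} → v ∈ p → χ p v ≡ 1
χ-∈ {p = p} {v} v∈ = cong (if_then 1 else 0) (dec-true (v ∈? p) v∈)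

χ-∉ : {p : Subset n} {v : Fin n} → v ∉ p → χ p v ≡ 0
χ-∉ {p = p} {v} v∉ = cong (if_then 1 else 0) (dec-false (v ∈? p) v∉)

∣p∣≡χ+∣p-x∣ : (p : Subset n) (x : Fin n) → ∣ p ∣ ≡ χ p x + ∣ p - x ∣
∣p∣≡χ+∣p-x∣ p x with x ∈? p
... | yes x∈ = ≤-antisym (∣p∣≤1+∣p-x∣ p x) (x∈p⇒∣p-x∣<∣p∣ x∈)
... | no x∉ = ≤-antisym (p⊆q⇒∣p∣≤∣q∣ {p = p} {q = p - x} λ v∈ → x∈p∧x≢y⇒x∈p-y v∈ λ { refl → x∉ v∈ }) (∣p─q∣≤∣p∣ p ⁅ x ⁆)

∣p∣≡sum-χ : ∀ {ℓ} (f : Fin ℓ → Fin n) → Injective _≡_ _≡_ f → (p : Subset n) →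
  (∀ {x} → x ∈ p → ∃ λ i → f i ≡ x) → ∣ p ∣ ≡ sum (χ p ∘ f)
∣p∣≡sum-χ {n} {zero} f inj p image = trans (cong ∣_∣ (Empty-unique λ (_ , x∈) → noFin (proj₁ (image x∈)))) (∣⊥∣≡0 n)
  where
  noFin : ¬ Fin 0
  noFin ()
∣p∣≡sum-χ {n} {suc ℓ} f inj p image = trans (∣p∣≡χ+∣p-x∣ p (f zero))
  (cong (χ p (f zero) +_) (trans (∣p∣≡sum-χ (f ∘ suc) (fsuc-injective ∘ inj) (p - f zero) image′) (sum-cong-≗ same)))
  where
  image′ : ∀ {x} → x ∈ p - f zero → ∃ λ i → f (suc i) ≡ x
  image′ x∈ with x∈p-y⁻ p (f zero) x∈
  ... | x∈p , x≢ with image x∈p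
  ...   | zero , eq = contradiction (sym eq) x≢
  ...   | suc i , eq = i , eq
  same : ∀ i → χ (p - f zero) (f (suc i)) ≡ χ p (f (suc i))
  same i with f (suc i) ∈? p
  ... | yes v∈ = χ-∈ (x∈p∧x≢y⇒x∈p-y v∈ λ eq → contradiction (inj eq) λ ())
  ... | no v∉ = χ-∉ (v∉ ∘ p─q⊆p p ⁅ f zero ⁆)

prefix-constant : ∀ {ℓ} {A : Set} (g : Fin (suc ℓ) → A) (j : Fin ℓ) →
  (∀ k → k Fin.< j → g (inject₁ k) ≡ g (suc k)) → g zero ≡ g (inject₁ j)
prefix-constant g zero step = refl
prefix-constant {suc ℓ} g (suc j) step =
  trans (step zero (s≤s z≤n)) (prefix-constant (g ∘ suc) j λ k k<j → step (suc k) (s≤s k<j))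

arc-constant : ∀ {ℓ} {A : Set} (g : Fin (suc ℓ) → A) (i j : Fin ℓ) → i Fin.< j →
  (∀ k → i Fin.< k → k Fin.< j → g (inject₁ k) ≡ g (suc k)) → g (suc i) ≡ g (inject₁ j)
arc-constant {suc ℓ} g zero (suc j) _ step =
  prefix-constant (g ∘ suc) j λ k k<j → step (suc k) (s≤s z≤n) (s≤s k<j)
arc-constant {suc ℓ} g (suc i) (suc j) (s≤s i<j) step =
  arc-constant (g ∘ suc) i j i<j λ k i<k k<j → step (suc k) (s≤s i<k) (s≤s k<j)

-- The unique odd cycle and the colourings after removal of one of its edges.

module OddCycle (G : Graph n) (C : Cycle G) (unique : IsUniqueOddCycle C) where

  vx nx : Fin (len C) → Fin n
  vx i = vertex C (inject₁ i)
  nx i = vertex C (suc i)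

  VC? : Decidable (VC C)
  VC? v = any? λ i → vertex C i ≟ v

  -- The last vertex repeats the first, so `vx` already runs through all of C.
  index : ∀ {v} → VC C v → ∃ λ i → vx i ≡ v
  index (k , refl) = go (nontrivial C) (vertex C) (closed C) k
    where
    go : ∀ {ℓ} → 0 < ℓ → (f : Fin (suc ℓ) → Fin n) → f zero ≡ f (fromℕ ℓ) → ∀ k → ∃ λ (i : Fin ℓ) → f (inject₁ i) ≡ f k
    go (s≤s _) f eq k with view k
    ... | ‵inj₁ {i = i} _ = i , refl
    ... | ‵fromℕ = zero , eq

  removeEdge : Fin (len C) → Graph n
  removeEdge m = record
    { V       = V G
    ; Adj     = λ u v → Adj G u v × ¬ SameEdge (u , v) (edge C m)
    ; adj?    = λ u v → adj? G u v ×-dec ¬? (sameEdge? (u , v) (edge C m))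
    ; adj-sym = λ (uv , ne) → adj-sym G uv , ne ∘ sameEdge-trans (inj₂ (refl , refl))
    ; adj-irr = λ eq (uv , _) → adj-irr G eq uv
    ; adj⇒∈V  = λ (uv , _) → adj⇒∈V G uv
    }

  -- An odd cycle avoiding the edge `m` would also be an odd cycle of `G`, but uniqueness forces it
  -- to contain all edges of C.
  removeEdge-bipartite : ∀ m → ∃ λ c → Colouring c (Adj (removeEdge m))
  removeEdge-bipartite m = no-oddCycle⇒bipartite (removeEdge m) λ C′ odd →
    let embedded : Cycle G
        embedded = record
          { len = len C′ ; vertex = vertex C′ ; nontrivial = nontrivial C′ ; walk = proj₁ ∘ walk C′
          ; trail = trail C′ ; closed = closed C′ ; simple = simple C′ }
        (i , same) = proj₂ (proj₂ (proj₂ unique embedded odd)) {proj₁ (edge C m)} {proj₂ (edge C m)} (m , inj₁ (refl , refl))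
    in proj₂ (walk C′ i) (sameEdge-sym same)

  colour : Fin (len C) → Fin n → Bool
  colour m = proj₁ (removeEdge-bipartite m)

  colour-proper : ∀ m {u v} → Adj G u v → ¬ SameEdge (u , v) (edge C m) → colour m u ≢ colour m v
  colour-proper m uv ne = proj₂ (removeEdge-bipartite m) (uv , ne)

  colour-edge : ∀ m i → i ≢ m → colour m (vx i) ≢ colour m (nx i)
  colour-edge m i i≢m = colour-proper m (walk C i) (i≢m ∘ trail C i m)

  -- Otherwise the two colours alternate along the odd cycle C.
  colour-monochromatic : ∀ m → colour m (vx m) ≡ colour m (nx m)
  colour-monochromatic m = decidable-stable (colour m (vx m) ≟ᵇ colour m (nx m)) λ differ →
    proj₁ unique (divides (sum (g ∘ inject₁)) (trans (sym (alternating differ)) (sum-edges g (cong (bit ∘ colour m) (closed C)))))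
    where
    bit : Bool → ℕ
    bit b = if b then 1 else 0
    g : Fin (suc (len C)) → ℕ
    g = bit ∘ colour m ∘ vertex C
    bits : ∀ {a b} → a ≢ b → bit a + bit b ≡ 1
    bits {false} {false} ne = contradiction refl ne
    bits {false} {true} ne = refl
    bits {true} {false} ne = refl
    bits {true} {true} ne = contradiction refl ne
    alternating : colour m (vx m) ≢ colour m (nx m) → sum (λ i → g (inject₁ i) + g (suc i)) ≡ len C
    alternating differ = ≤-antisym (sum-≤ _ (≤-reflexive ∘ one)) (sum-≥ _ (≤-reflexive ∘ sym ∘ one))
      where
      one : ∀ i → g (inject₁ i) + g (suc i) ≡ 1
      one i with i ≟ m
      ... | yes refl = bits differ
      ... | no i≢m = bits (colour-edge m i i≢m)

  private
    opposite? : ∀ m → Decidable (λ v → VC C v × colour m v ≢ colour m (vx m))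
    opposite? m v = VC? v ×-dec ¬? (colour m v ≟ᵇ colour m (vx m))

  opposite : Fin (len C) → Subset n
  opposite m = select (opposite? m)

  opposite⁺ : ∀ m {v} → VC C v → colour m v ≢ colour m (vx m) → v ∈ opposite m
  opposite⁺ m v∈C ne = ∈-select⁺ (opposite? m) (v∈C , ne)

  opposite⁻ : ∀ m {v} → v ∈ opposite m → VC C v × colour m v ≢ colour m (vx m)
  opposite⁻ m = ∈-select⁻ (opposite? m)

  -- Only the edge `m` may violate the colouring, and its end `vx m` has the excluded colour.
  opposite-stable : ∀ m → Stable (Adj G) (opposite m)
  opposite-stable m {u} {v} u∈ v∈ uv with sameEdge? (u , v) (edge C m) | proj₂ (opposite⁻ m u∈) | proj₂ (opposite⁻ m v∈)
  ... | yes (inj₁ (refl , _)) | ne | _ = ne refl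
  ... | yes (inj₂ (_ , refl)) | _ | ne = ne refl
  ... | no other | neᵘ | neᵛ = colour-proper m uv other (trans (¬-not neᵘ) (sym (¬-not neᵛ)))

  -- Every edge of C has at most one end in T, and every edge but the m-th one
  -- has an end in the colour class.
  opposite-maximum : ∀ m {T} → (∀ {v} → v ∈ T → VC C v) → Stable (Adj G) T → ∣ T ∣ ≤ ∣ opposite m ∣
  opposite-maximum m {T} T⊆C stable = halve (begin
      ∣ T ∣ * 2                                           ≡⟨ double T⊆C ⟩
      sum (λ i → χ T (vx i) + χ T (nx i))                 ≤⟨ sum-≤ _ atMost ⟩
      len C                                               ≤⟨ sum-≥-except _ m atLeast ⟩
      suc (sum (λ i → χ O (vx i) + χ O (nx i)))           ≡⟨ cong suc (sym (double (proj₁ ∘ opposite⁻ m))) ⟩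
      suc (∣ O ∣ * 2)                                     ∎)
    where
    open ≤-Reasoning
    O = opposite m
    double : ∀ {p} → (∀ {v} → v ∈ p → VC C v) → ∣ p ∣ * 2 ≡ sum (λ i → χ p (vx i) + χ p (nx i))
    double {p} p⊆C = trans (cong (_* 2) (∣p∣≡sum-χ vx (simple C) p (index ∘ p⊆C)))
                           (sym (sum-edges (χ p ∘ vertex C) (cong (χ p) (closed C))))
    atMost : ∀ i → χ T (vx i) + χ T (nx i) ≤ 1
    atMost i with vx i ∈? T | nx i ∈? T
    ... | yes a | yes b = contradiction (walk C i) (stable a b)
    ... | yes _ | no _ = ≤-refl
    ... | no _ | yes _ = ≤-refl
    ... | no _ | no _ = z≤n
    atLeast : ∀ i → i ≢ m → 1 ≤ χ O (vx i) + χ O (nx i)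
    atLeast i i≢m with colour m (vx i) ≟ᵇ colour m (vx m)
    ... | no ne = ≤-trans (≤-reflexive (sym (χ-∈ (opposite⁺ m (inject₁ i , refl) ne)))) (m≤m+n _ _)
    ... | yes eq = ≤-trans (≤-reflexive (sym (χ-∈ (opposite⁺ m (suc i , refl)
                     λ eq′ → colour-edge m i i≢m (trans eq (sym eq′)))))) (m≤n+m _ (χ O (vx i)))
    -- The extra 1 allowed for the edge `m` disappears by parity.
    halve : ∀ {a b} → a * 2 ≤ suc (b * 2) → a ≤ b
    halve {zero} _ = z≤n
    halve {suc a} {zero} (s≤s ())
    halve {suc a} {suc b} (s≤s (s≤s le)) = s≤s (halve le)

  opposite-avoiding : ∀ {y} → VC C y → ∃ λ m → y ∉ opposite m
  opposite-avoiding y∈C with index y∈C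
  ... | m , refl = m , λ y∈ → proj₂ (opposite⁻ m y∈) refl

  -- Let `i` be the edge of C starting at `y`, and let `m` be the edge following it. The ends of `i`
  -- get different colours, and its far end `vx m` has the excluded one.
  opposite-containing : ∀ {y} → VC C y → ∃ λ m → y ∈ opposite m
  opposite-containing y∈C with index y∈C
  ... | i , refl with index (suc i , refl)
  ...   | m , vm≡ni = m , opposite⁺ m y∈C λ eq → colour-edge m i i≢m (trans eq (cong (colour m) vm≡ni))
    where
    i≢m : i ≢ m
    i≢m refl = adj-irr G vm≡ni (walk C i)

  private
    G∖C : Graph n
    G∖C = deleteEdges G C

  -- colour i xor colour j is constant along walks in G − E(C) and along the arc
  -- of C strictly after the edge i and up to the start of the edge j, but it
  -- changes across the edge i.
  separated : ∀ i j → i Fin.< j → ¬ Reachable G∖C (vx i) (vx j)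
  -- The colouring `colour i` agrees on the two ends of the edge `i`. Cancelling it leaves
  -- `colour j` equal there too, which is impossible for different edges.
  separated i j i<j path = colour-edge j i (<ᶠ⇒≢ i<j) (cancel (colour i (vx i)) (begin
      colour i (vx i) xor colour j (vx i)   ≡⟨ along path ⟩
      colour i (vx j) xor colour j (vx j)   ≡⟨ sym (arc-constant (d ∘ vertex C) i j i<j λ k i<k k<j →
                                                 flip (colour-edge i k (<ᶠ⇒≢ i<k ∘ sym)) (colour-edge j k (<ᶠ⇒≢ k<j))) ⟩
      colour i (nx i) xor colour j (nx i)   ≡⟨ cong (_xor colour j (nx i)) (sym (colour-monochromatic i)) ⟩
      colour i (vx i) xor colour j (nx i)   ∎))
    where
    open ≡-Reasoning
    d : Fin n → Bool
    d v = colour i v xor colour j v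
    flip : ∀ {a a′ b b′} → a ≢ a′ → b ≢ b′ → a xor b ≡ a′ xor b′
    flip {a} {a′} {b} {b′} ne ne′ =
      trans (cong₂ _xor_ (¬-not ne) (¬-not ne′)) (xor-annihilates-not a′ b′)
    along : ∀ {u v} → Reachable G∖C u v → d u ≡ d v
    along ε = refl
    along ((uv , uv∉C) ◅ p) = trans
      (flip (colour-proper i uv λ s → uv∉C (i , s)) (colour-proper j uv λ s → uv∉C (j , s))) (along p)
    cancel : ∀ a {b b′} → a xor b ≡ a xor b′ → b ≡ b′
    cancel false eq = eq
    cancel true eq = not-injective eq

  reachable-unique : ∀ {y z} → VC C y → VC C z → Reachable G∖C y z → y ≡ z
  reachable-unique y∈C z∈C path with index y∈C | index z∈C
  ... | i , refl | j , refl with <ᶠ-cmp i j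
  ...   | tri< i<j _ _ = contradiction path (separated i j i<j)
  ...   | tri≈ _ refl _ = refl
  ...   | tri> _ _ j<i = contradiction (reverse (adj-sym G∖C) path) (separated j i j<i)

-- Branches of a non-König-Egerváry graph.

linked⇒adj : (G : Graph n) {M : List (Edge n)} → Matching G M → ∀ {u v} → Linked M u v → Adj G u v
linked⇒adj G (edges , _) link with find link
... | f , f∈ , inj₁ (refl , refl) = All-lookup edges f∈
... | f , f∈ , inj₂ (refl , refl) = adj-sym G (All-lookup edges f∈)

stable-∪ : (G : Graph n) {S T : Subset n} → Stable (Adj G) S → Stable (Adj G) T →
  (∀ {u v} → u ∈ S → v ∈ T → ¬ Adj G u v) → Stable (Adj G) (S ∪ˢ T)
stable-∪ G {S} {T} stableˢ stableᵗ apart u∈ v∈ uv with x∈p∪q⁻ S T u∈ | x∈p∪q⁻ S T v∈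
... | inj₁ u∈S | inj₁ v∈S = stableˢ u∈S v∈S uv
... | inj₁ u∈S | inj₂ v∈T = apart u∈S v∈T uv
... | inj₂ u∈T | inj₁ v∈S = apart v∈S u∈T (adj-sym G uv)
... | inj₂ u∈T | inj₂ v∈T = stableᵗ u∈T v∈T uv

module NonKönigEgerváry (G : Graph n) (C : Cycle G) (unique : IsUniqueOddCycle C)
                        (¬KE : ¬ KönigEgerváry G) where

  open OddCycle G C unique

  private
    G∖C : Graph n
    G∖C = deleteEdges G C

    R : Fin n → Subset n
    R y = proj₁ (reachableSet G∖C y)

  on off : Subset n
  on = select VC?
  off = V G ∩ ∁ on

  on⁺ : ∀ {v} → VC C v → v ∈ on
  on⁺ = ∈-select⁺ VC?

  on⁻ : ∀ {v} → v ∈ on → VC C v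
  on⁻ = ∈-select⁻ VC?

  off⁺ : ∀ {v} → v ∈ V G → ¬ VC C v → v ∈ off
  off⁺ v∈V v∉C = x∈p∩q⁺ (v∈V , x∉p⇒x∈∁p (v∉C ∘ on⁻))

  off⁻ : ∀ {v} → v ∈ off → v ∈ V G × ¬ VC C v
  off⁻ v∈ with x∈p∩q⁻ (V G) (∁ on) v∈
  ... | v∈V , v∈∁ = v∈V , x∈∁p⇒x∉p v∈∁ ∘ on⁺

  VC⊆V : ∀ {v} → VC C v → v ∈ V G
  VC⊆V v∈C with index v∈C
  ... | i , refl = adj⇒∈V G (walk C i)

  cycleEdge : ∀ {u v} → EC C u v → VC C u × VC C v
  cycleEdge (i , inj₁ (refl , refl)) = (inject₁ i , refl) , (suc i , refl)
  cycleEdge (i , inj₂ (refl , refl)) = (suc i , refl) , (inject₁ i , refl)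

  EC? : ∀ u v → Dec (EC C u v)
  EC? u v = any? λ i → sameEdge? (u , v) (edge C i)

  module Branch {y : Fin n} (y∈C : VC C y) where

    H : Subset n
    H = V (D G C y -ᵛ y)

    y∈R : y ∈ R y
    y∈R = reach⁺ G∖C {y} ε

    R-next : ∀ {u v} → u ∈ R y → Adj G∖C u v → v ∈ R y
    R-next u∈ uv = reach⁺ G∖C (reach⁻ G∖C u∈ ◅◅ (uv ◅ ε))

    R∩C : ∀ {v} → v ∈ R y → VC C v → v ≡ y
    R∩C v∈R v∈C = sym (reachable-unique y∈C v∈C (reach⁻ G∖C v∈R))

    -- Only an edge of C can leave the branch, and `y` is the only vertex of the branch on C.
    exit : ∀ {u v} → u ∈ R y → v ∉ R y → Adj G u v → u ≡ y
    exit {u} {v} u∈R v∉R uv with EC? u v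
    ... | yes uv∈C = R∩C u∈R (proj₁ (cycleEdge uv∈C))
    ... | no uv∉C = contradiction (R-next u∈R (uv , uv∉C)) v∉R

    H⁺ : ∀ {v} → v ∈ V G → v ∈ R y → v ≢ y → v ∈ H
    H⁺ v∈V v∈R v≢y = x∈p∩q⁺ (x∈p∩q⁺ (v∈V , v∈R) , x∉p⇒x∈∁p (x≢y⇒x∉⁅y⁆ v≢y))

    H⁻ : ∀ {v} → v ∈ H → v ∈ V G × v ∈ R y × v ≢ y
    H⁻ v∈ with x∈p∩q⁻ (V G ∩ R y) (∁ ⁅ y ⁆) v∈
    ... | v∈D , v∈∁ with x∈p∩q⁻ (V G) (R y) v∈D
    ...   | v∈V , v∈R = v∈V , v∈R , x∉⁅y⁆⇒x≢y (x∈∁p⇒x∉p v∈∁)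

    H⊆off : H ⊆ off
    H⊆off v∈ with H⁻ v∈
    ... | v∈V , v∈R , v≢y = off⁺ v∈V (v≢y ∘ R∩C v∈R)

    -- No vertex of `H` lies on C, so all its edges survive in G - E(C) and stay in the branch.
    H-next : ∀ {u v} → u ∈ H → Adj G u v → v ∈ H ⊎ v ≡ y
    H-next {u} {v} u∈H uv with v ≟ y
    ... | yes v≡y = inj₂ v≡y
    ... | no v≢y = inj₁ (H⁺ (adj⇒∈V G (adj-sym G uv))
            (R-next (proj₁ (proj₂ (H⁻ u∈H))) (uv , proj₂ (off⁻ (H⊆off u∈H)) ∘ proj₁ ∘ cycleEdge)) v≢y)

    H-stable⁺ : ∀ {T} → Independent (D G C y -ᵛ y) T → T ⊆ H × Stable (Adj G) T
    H-stable⁺ {T} (T⊆H , indep) = T⊆H , λ u∈ v∈ uv →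
      let (_ , u∈R , u≢y) = H⁻ (T⊆H u∈)
          (_ , v∈R , v≢y) = H⁻ (T⊆H v∈)
      in indep u∈ v∈ (((uv , proj₂ (off⁻ (H⊆off (T⊆H u∈))) ∘ proj₁ ∘ cycleEdge) , u∈R , v∈R) ,
                      x∉p⇒x∈∁p (x≢y⇒x∉⁅y⁆ u≢y) , x∉p⇒x∈∁p (x≢y⇒x∉⁅y⁆ v≢y))

    H-stable⁻ : ∀ {T} → T ⊆ H → Stable (Adj G) T → Independent (D G C y -ᵛ y) T
    H-stable⁻ T⊆H stable = T⊆H , λ u∈ v∈ (((uv , _) , _) , _) → stable u∈ v∈ uv

    private
      SameSide : Fin n → Fin n → Set
      SameSide u v = (u ∈ R y × v ∈ R y) ⊎ (u ∉ R y × v ∉ R y)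

      cut : Graph n
      cut = record
        { V       = V G
        ; Adj     = λ u v → Adj G u v × SameSide u v
        ; adj?    = λ u v → adj? G u v ×-dec
                      ((u ∈? R y ×-dec v ∈? R y) ⊎-dec (¬? (u ∈? R y) ×-dec ¬? (v ∈? R y)))
        ; adj-sym = λ (uv , side) → adj-sym G uv ,
                      [ (λ (a , b) → inj₁ (b , a)) , (λ (a , b) → inj₂ (b , a)) ]′ side
        ; adj-irr = λ eq (uv , _) → adj-irr G eq uv
        ; adj⇒∈V  = λ (uv , _) → adj⇒∈V G uv
        }

      -- The edge `m` of C starting at `y` ends at another vertex of C, hence outside the branch.
      -- The cut removes it, and `colour m` is proper on what remains.
      cut-bipartite : ∃ λ c → Colouring c (Adj cut)
      cut-bipartite with index y∈C
      ... | m , refl = colour m , λ (uv , side) → colour-proper m uv (notEdge side)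
        where
        nx∉R : nx m ∉ R (vx m)
        nx∉R nx∈R = adj-irr G (sym (R∩C nx∈R (suc m , refl))) (walk C m)
        notEdge : ∀ {u v} → SameSide u v → ¬ SameEdge (u , v) (edge C m)
        notEdge (inj₁ (_ , b)) (inj₁ (refl , refl)) = nx∉R b
        notEdge (inj₁ (a , _)) (inj₂ (refl , refl)) = nx∉R a
        notEdge (inj₂ (a , _)) (inj₁ (refl , refl)) = a y∈R
        notEdge (inj₂ (_ , b)) (inj₂ (refl , refl)) = b y∈R

    -- Take a König pair (S , M) of the bipartite graph obtained by cutting the
    -- branch off.  If S misses y, or if some stable T in H is as large as the part
    -- of S in the branch, then M also certifies that G is König-Egerváry.
    opaque
      branch-set : ∃ λ S → S ⊆ H × Stable (Adj G) S × (∀ {v} → v ∈ S → ¬ Adj G v y) ×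
                   (∀ {T} → T ⊆ H → Stable (Adj G) T → ∣ T ∣ ≤ ∣ S ∣)
      branch-set with uncurry (bipartite-könig cut) cut-bipartite
      ... | S , M , (S⊆V , indep) , (edges , disjoint) , tight =
        S ∩ H , p∩q⊆q S H , (λ u∈ v∈ uv → indep (p∩q⊆p S H u∈) (p∩q⊆p S H v∈)
                               (uv , inj₁ (inR (p∩q⊆q S H u∈) , inR (p∩q⊆q S H v∈)))) ,
        (λ v∈ vy → indep (p∩q⊆p S H v∈) y∈S (vy , inj₁ (inR (p∩q⊆q S H v∈) , y∈R))) ,
        maximum
        where
        inR : ∀ {v} → v ∈ H → v ∈ R y
        inR v∈ = proj₁ (proj₂ (H⁻ v∈))

        noCertificate : ∀ {T} → T ⊆ V G → Stable (Adj G) T → ¬ ∣ S ∣ ≤ ∣ T ∣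
        noCertificate T⊆V stable le = ¬KE (certificate⇒KönigEgerváry G (T⊆V , stable)
          (All-map proj₁ edges , disjoint) (≤-trans tight (+-monoˡ-≤ (length M) le)))

        -- Every edge destroyed by the cut has `y` as its end in the branch, so a set `S` without
        -- `y` would be stable in `G`.
        y∈S : y ∈ S
        y∈S = decidable-stable (y ∈? S) λ y∉S → noCertificate S⊆V (stable y∉S) ≤-refl
          where
          stable : y ∉ S → Stable (Adj G) S
          stable y∉S {u} {v} u∈ v∈ uv with u ∈? R y | v ∈? R y
          ... | yes a | yes b = indep u∈ v∈ (uv , inj₁ (a , b))
          ... | no a | no b = indep u∈ v∈ (uv , inj₂ (a , b))
          ... | yes a | no b = y∉S (subst (_∈ S) (exit a b uv) u∈)
          ... | no a | yes b = y∉S (subst (_∈ S) (exit b a (adj-sym G uv)) v∈)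

        -- A larger `T` replaces the part of `S` in the branch: its extra vertex makes up for `y`,
        -- and without `y` no edge leads out of the branch.
        maximum : ∀ {T} → T ⊆ H → Stable (Adj G) T → ∣ T ∣ ≤ ∣ S ∩ H ∣
        maximum {T} T⊆H stableᵗ = ≮⇒≥ λ larger → noCertificate S′⊆V S′-stable (begin
            ∣ S ∣                               ≤⟨ ∣p∣≤∣p─q∣+∣p∩q∣ S (R y) ⟩
            ∣ S ─ R y ∣ + ∣ S ∩ R y ∣           ≤⟨ +-monoʳ-≤ _ (∣p∣≤1+∣p-x∣ (S ∩ R y) y) ⟩
            ∣ S ─ R y ∣ + suc ∣ S ∩ R y - y ∣   ≤⟨ +-monoʳ-≤ _ (s≤s (p⊆q⇒∣p∣≤∣q∣ inside)) ⟩
            ∣ S ─ R y ∣ + suc ∣ S ∩ H ∣         ≤⟨ +-monoʳ-≤ _ larger ⟩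
            ∣ S ─ R y ∣ + ∣ T ∣                 ≡⟨ sym (∣∪∣-disjoint (S ─ R y) T λ v∈ v∈T → x∈p─q⇒x∉q S (R y) v∈ (inR (T⊆H v∈T))) ⟩
            ∣ (S ─ R y) ∪ˢ T ∣                   ∎)
          where
          open ≤-Reasoning
          inside : S ∩ R y - y ⊆ S ∩ H
          inside v∈ with x∈p-y⁻ (S ∩ R y) y v∈
          ... | v∈SR , v≢y with x∈p∩q⁻ S (R y) v∈SR
          ...   | v∈S , v∈R = x∈p∩q⁺ (v∈S , H⁺ (S⊆V v∈S) v∈R v≢y)
          S′⊆V : (S ─ R y) ∪ˢ T ⊆ V G
          S′⊆V = [ S⊆V ∘ p─q⊆p S (R y) , proj₁ ∘ H⁻ ∘ T⊆H ]′ ∘ x∈p∪q⁻ (S ─ R y) T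
          S′-stable : Stable (Adj G) ((S ─ R y) ∪ˢ T)
          S′-stable = stable-∪ G
            (λ u∈ v∈ uv → indep (p─q⊆p S (R y) u∈) (p─q⊆p S (R y) v∈)
               (uv , inj₂ (x∈p─q⇒x∉q S (R y) u∈ , x∈p─q⇒x∉q S (R y) v∈)))
            stableᵗ
            (λ u∈ v∈T uv → proj₂ (proj₂ (H⁻ (T⊆H v∈T)))
               (exit (inR (T⊆H v∈T)) (x∈p─q⇒x∉q S (R y) u∈) (adj-sym G uv)))

    module Swap {S T : Subset n} (S⊆off : S ⊆ off) (stableˢ : Stable (Adj G) S)
                (T⊆H : T ⊆ H) (stableᵗ : Stable (Adj G) T) where

      swapped : Subset n
      swapped = (S ─ H) ∪ˢ T

      swapped⊆off : swapped ⊆ off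
      swapped⊆off = [ S⊆off ∘ p─q⊆p S H , H⊆off ∘ T⊆H ]′ ∘ x∈p∪q⁻ (S ─ H) T

      -- The only possible neighbour of `H` outside `H` is `y`, which lies on C and hence not in
      -- `S`.
      swapped-stable : Stable (Adj G) swapped
      swapped-stable = stable-∪ G (λ u∈ v∈ → stableˢ (p─q⊆p S H u∈) (p─q⊆p S H v∈)) stableᵗ apart
        where
        apart : ∀ {u v} → u ∈ S ─ H → v ∈ T → ¬ Adj G u v
        apart u∈ v∈T uv with H-next (T⊆H v∈T) (adj-sym G uv)
        ... | inj₁ u∈H = x∈p─q⇒x∉q S H u∈ u∈H
        ... | inj₂ refl = proj₂ (off⁻ (S⊆off (p─q⊆p S H u∈))) y∈C

      ∣swapped∣ : ∣ swapped ∣ ≡ ∣ S ─ H ∣ + ∣ T ∣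
      ∣swapped∣ = ∣∪∣-disjoint (S ─ H) T λ v∈ v∈T → x∈p─q⇒x∉q S H v∈ (T⊆H v∈T)

      ∣S∣≤∣swapped∣ : ∣ S ∩ H ∣ ≤ ∣ T ∣ → ∣ S ∣ ≤ ∣ swapped ∣
      ∣S∣≤∣swapped∣ le = begin
        ∣ S ∣                   ≤⟨ ∣p∣≤∣p─q∣+∣p∩q∣ S H ⟩
        ∣ S ─ H ∣ + ∣ S ∩ H ∣   ≤⟨ +-monoʳ-≤ _ le ⟩
        ∣ S ─ H ∣ + ∣ T ∣       ≡⟨ sym ∣swapped∣ ⟩
        ∣ swapped ∣             ∎
        where open ≤-Reasoning

    ∩H-stable : ∀ {S} → Stable (Adj G) S → Stable (Adj G) (S ∩ H)
    ∩H-stable {S} stable u∈ v∈ = stable (p∩q⊆p S H u∈) (p∩q⊆p S H v∈)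

  open Branch using (H; H-next; H⊆off)

  -- Maximum stable sets off the cycle and their completion on it.

  m₀ : Fin (len C)
  m₀ = fromℕ< (nontrivial C)

  private
    B : Graph n
    B = induced G (∁ on)

    B-könig : ∃₂ λ S M → Independent B S × Matching B M × order B ≤ ∣ S ∣ + length M
    -- Deleting V(C) deletes the edge `m₀`, so its colouring is proper on `B`.
    B-könig = bipartite-könig B (colour m₀) λ { (uv , u∈ , _) → colour-proper m₀ uv λ s →
      x∈∁p⇒x∉p u∈ (on⁺ (proj₁ (cycleEdge (m₀ , s)))) }

    S₁ : Subset n
    S₁ = proj₁ B-könig

    M₁ : List (Edge n)
    M₁ = proj₁ (proj₂ B-könig)

    M₁-matching : Matching B M₁
    M₁-matching = proj₁ (proj₂ (proj₂ (proj₂ B-könig)))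

    B-tight : order B ≤ ∣ S₁ ∣ + length M₁
    B-tight = proj₂ (proj₂ (proj₂ (proj₂ B-könig)))

    B-independent : ∀ {T} → T ⊆ off → Stable (Adj G) T → Independent B T
    B-independent T⊆off stable = T⊆off , λ u∈ v∈ (uv , _) → stable u∈ v∈ uv

    S₁⊆off : S₁ ⊆ off
    S₁⊆off = proj₁ (proj₁ (proj₂ (proj₂ B-könig)))

    S₁-stable : Stable (Adj G) S₁
    S₁-stable u∈ v∈ uv = proj₂ (proj₁ (proj₂ (proj₂ B-könig))) u∈ v∈
      (uv , proj₂ (x∈p∩q⁻ (V G) (∁ on) (S₁⊆off u∈)) , proj₂ (x∈p∩q⁻ (V G) (∁ on) (S₁⊆off v∈)))

    S₁-maximum : ∀ {T} → T ⊆ off → Stable (Adj G) T → ∣ T ∣ ≤ ∣ S₁ ∣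
    S₁-maximum T⊆off stable = +-cancelʳ-≤ (length M₁) _ _
      (≤-trans (independent+matching≤order B (B-independent T⊆off stable) M₁-matching) B-tight)

    opaque
      -- Induction on the list, exchanging the branch at `vx i` for its `branch-set`. All neighbours
      -- of `vx i` off C lie in that branch, and vertices of the branch have no neighbour on C other
      -- than its root, so cycle vertices treated before remain avoided.
      avoiding : (is : List (Fin (len C))) → ∃ λ S → S ⊆ off × Stable (Adj G) S × ∣ S₁ ∣ ≤ ∣ S ∣ ×
                 (∀ {i v} → i ∈ᴸ is → v ∈ S → ¬ Adj G v (vx i))
      avoiding [] = S₁ , S₁⊆off , S₁-stable , ≤-refl , λ ()
      avoiding (i ∷ is) with avoiding is | Branch.branch-set {vx i} (inject₁ i , refl)
      ... | S , S⊆off , stable , large , apart | T , T⊆H , stableᵗ , avoids , maximum =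
        swapped , swapped⊆off , swapped-stable ,
        ≤-trans large (∣S∣≤∣swapped∣ (maximum (p∩q⊆q S (H i∈C)) (∩H-stable stable))) ,
        λ i∈ → [ old i∈ , new i∈ ]′ ∘ x∈p∪q⁻ (S ─ H i∈C) T
        where
        i∈C : VC C (vx i)
        i∈C = inject₁ i , refl
        open Branch i∈C using (module Swap; ∩H-stable; R-next; y∈R; H⁺)
        open Swap S⊆off stable T⊆H stableᵗ
        old : ∀ {j v} → j ∈ᴸ i ∷ is → v ∈ S ─ H i∈C → ¬ Adj G v (vx j)
        old (there j∈) v∈ = apart j∈ (p─q⊆p S (H i∈C) v∈)
        old {v = v} (here refl) v∈ vy with off⁻ (S⊆off (p─q⊆p S (H i∈C) v∈))
        ... | v∈V , v∉C = x∈p─q⇒x∉q S (H i∈C) v∈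
                (H⁺ v∈V (R-next y∈R (adj-sym G vy , v∉C ∘ proj₂ ∘ cycleEdge)) λ { refl → v∉C i∈C })
        new : ∀ {j v} → j ∈ᴸ i ∷ is → v ∈ T → ¬ Adj G v (vx j)
        new {j} _ v∈T vz with H-next i∈C (T⊆H v∈T) vz
        ... | inj₁ z∈H = proj₂ (off⁻ (H⊆off i∈C z∈H)) (inject₁ j , refl)
        ... | inj₂ z≡y = avoids v∈T (subst (Adj G _) z≡y vz)

    S₀ : Subset n
    S₀ = proj₁ (avoiding (allFin _))

    S₀⊆off : S₀ ⊆ off
    S₀⊆off = proj₁ (proj₂ (avoiding (allFin _)))

    S₀-stable : Stable (Adj G) S₀
    S₀-stable = proj₁ (proj₂ (proj₂ (avoiding (allFin _))))

    S₁≤S₀ : ∣ S₁ ∣ ≤ ∣ S₀ ∣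
    S₁≤S₀ = proj₁ (proj₂ (proj₂ (proj₂ (avoiding (allFin _)))))

    S₀-apart : ∀ {u v} → u ∈ S₀ → VC C v → ¬ Adj G u v
    S₀-apart u∈ v∈C with index v∈C
    ... | i , refl = proj₂ (proj₂ (proj₂ (proj₂ (avoiding (allFin _))))) (∈-allFin i) u∈

    split : ∀ {T} → Independent G T → (T ─ on ⊆ off) × Stable (Adj G) (T ─ on) × (∣ T ∩ on ∣ ≤ ∣ opposite m₀ ∣)
    split {T} (T⊆V , stable) =
      (λ v∈ → off⁺ (T⊆V (p─q⊆p T on v∈)) (x∈p─q⇒x∉q T on v∈ ∘ on⁺)) ,
      (λ u∈ v∈ → stable (p─q⊆p T on u∈) (p─q⊆p T on v∈)) ,
      opposite-maximum m₀ (on⁻ ∘ p∩q⊆q T on) (λ u∈ v∈ → stable (p∩q⊆p T on u∈) (p∩q⊆p T on v∈))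

    -- A stable set has at most as many vertices off C as `S₁`, and at most as many on C as
    -- `opposite m`; the union attains both bounds.
    glue : ∀ m {S} → S ⊆ off → Stable (Adj G) S → (∀ {u v} → u ∈ S → v ∈ opposite m → ¬ Adj G u v) →
           ∣ S₁ ∣ ≤ ∣ S ∣ → MaximumIndependent G (S ∪ˢ opposite m)
    glue m {S} S⊆off stable apart large =
      ([ proj₁ ∘ off⁻ ∘ S⊆off , VC⊆V ∘ proj₁ ∘ opposite⁻ m ]′ ∘ x∈p∪q⁻ S (opposite m) ,
       stable-∪ G stable (opposite-stable m) apart) ,
      bound
      where
      bound : ∀ T → Independent G T → ∣ T ∣ ≤ ∣ S ∪ˢ opposite m ∣
      bound T indep with split indep
      ... | T⊆off , T-stable , _ = begin
        ∣ T ∣                       ≤⟨ ∣p∣≤∣p─q∣+∣p∩q∣ T on ⟩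
        ∣ T ─ on ∣ + ∣ T ∩ on ∣     ≤⟨ +-mono-≤ (≤-trans (S₁-maximum T⊆off T-stable) large)
                                        (opposite-maximum m (on⁻ ∘ p∩q⊆q T on) (λ u∈ v∈ → proj₂ indep (p∩q⊆p T on u∈) (p∩q⊆p T on v∈))) ⟩
        ∣ S ∣ + ∣ opposite m ∣      ≡⟨ sym (∣∪∣-disjoint S (opposite m) λ v∈S v∈O → proj₂ (off⁻ (S⊆off v∈S)) (proj₁ (opposite⁻ m v∈O))) ⟩
        ∣ S ∪ˢ opposite m ∣          ∎
        where open ≤-Reasoning

    S₀∪opposite : ∀ m → MaximumIndependent G (S₀ ∪ˢ opposite m)
    S₀∪opposite m = glue m S₀⊆off S₀-stable (λ u∈ v∈ → S₀-apart u∈ (proj₁ (opposite⁻ m v∈))) S₁≤S₀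

    -- A maximum independent set is at least as large as `S₀ ∪ˢ opposite m₀`, but has no more
    -- vertices on C than `opposite m₀`.
    ─on-large : ∀ {S} → MaximumIndependent G S → ∣ S₁ ∣ ≤ ∣ S ─ on ∣
    ─on-large {S} (indep , maximum) with split indep | S₀∪opposite m₀
    ... | _ , _ , small | indep₀ , _ = +-cancelʳ-≤ ∣ opposite m₀ ∣ _ _ (begin
      ∣ S₁ ∣ + ∣ opposite m₀ ∣        ≤⟨ +-monoˡ-≤ _ S₁≤S₀ ⟩
      ∣ S₀ ∣ + ∣ opposite m₀ ∣        ≡⟨ sym (∣∪∣-disjoint S₀ (opposite m₀) λ v∈S v∈O → proj₂ (off⁻ (S₀⊆off v∈S)) (proj₁ (opposite⁻ m₀ v∈O))) ⟩
      ∣ S₀ ∪ˢ opposite m₀ ∣            ≤⟨ maximum _ indep₀ ⟩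
      ∣ S ∣                           ≤⟨ ∣p∣≤∣p─q∣+∣p∩q∣ S on ⟩
      ∣ S ─ on ∣ + ∣ S ∩ on ∣         ≤⟨ +-monoʳ-≤ _ small ⟩
      ∣ S ─ on ∣ + ∣ opposite m₀ ∣    ∎)
      where open ≤-Reasoning

  -- The corona and the neighbourhood of the core.

  VC⊆corona : ∀ {v} → VC C v → corona G v
  VC⊆corona v∈C with opposite-containing v∈C
  ... | m , v∈O = S₀ ∪ˢ opposite m , S₀∪opposite m , q⊆p∪q S₀ (opposite m) v∈O

  -- Comparison with the known maximum set `S₀ ∪ˢ opposite m₀` turns maximality into a decidable
  -- bound on the size.
  corona? : Decidable (corona G)
  corona? v with anySubset? (λ S → independent? S ×-dec ((∣ S₀ ∪ˢ opposite m₀ ∣ ≤? ∣ S ∣) ×-dec (v ∈? S)))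
    where
    independent? : ∀ S → Dec (Independent G S)
    independent? S with S ⊆? V G | any? (λ u → any? λ w → u ∈? S ×-dec (w ∈? S ×-dec adj? G u w))
    ... | no S⊈V | _ = no λ (S⊆V , _) → S⊈V S⊆V
    ... | yes _ | yes (u , w , u∈ , w∈ , uw) = no λ (_ , stable) → stable u∈ w∈ uw
    ... | yes S⊆V | no none = yes (S⊆V , λ u∈ w∈ uw → none (_ , _ , u∈ , w∈ , uw))
  ... | yes (S , indep , large , v∈S) = yes (S , (indep , λ T indepᵗ → ≤-trans (proj₂ (S₀∪opposite m₀) T indepᵗ) large) , v∈S)
  ... | no none = no λ (S , (indep , maximum) , v∈S) → none (S , indep , maximum _ (proj₁ (S₀∪opposite m₀)) , v∈S)

  -- The neighbour is the partner of v in a maximum matching of G − V(C): that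
  -- matching saturates the complement of every maximum independent set there.
  non-corona⇒N-core : ∀ {v} → v ∈ V G → ¬ corona G v → N G (core G) v
  non-corona⇒N-core {v} v∈V v∉corona with any? (λ u → anyᴸ? (sameEdge? (v , u)) M₁)
  ... | yes (u , link) = u , partner-in-core , adj-sym G (proj₁ (linked⇒adj B M₁-matching link))
    where
    partner-in-core : core G u
    partner-in-core S maxS with split (proj₁ maxS)
    ... | S⊆off , stable , _ = p─q⊆p S on (partner∈ B (B-independent S⊆off stable) M₁-matching
            (≤-trans B-tight (+-monoˡ-≤ (length M₁) (─on-large maxS)))
            (off⁺ v∈V (v∉corona ∘ VC⊆corona))
            (λ v∈ → v∉corona (S , maxS , p─q⊆p S on v∈)) link)
  ... | no none with split (proj₁ (S₀∪opposite m₀))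
  ...   | S⊆off , stable , _ = ⊥-elim (covered B (B-independent S⊆off stable) M₁-matching
            (≤-trans B-tight (+-monoˡ-≤ (length M₁) (─on-large (S₀∪opposite m₀))))
            (off⁺ v∈V (v∉corona ∘ VC⊆corona))
            (λ v∈ → v∉corona (_ , S₀∪opposite m₀ , p─q⊆p _ on v∈))
            (λ u link → none (u , link)))

  corona∪N-core : (corona G ∪ N G (core G)) ≐ (_∈ V G)
  corona∪N-core = [ (λ (S , ((S⊆V , _) , _) , v∈S) → S⊆V v∈S) , (λ (_ , _ , uv) → adj⇒∈V G (adj-sym G uv)) ]′ , cover
    where
    cover : ∀ {v} → v ∈ V G → corona G v ⊎ N G (core G) v
    cover {v} v∈V with corona? v
    ... | yes v∈corona = inj₁ v∈corona
    ... | no v∉corona = inj₂ (non-corona⇒N-core v∈V v∉corona)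

  -- The corona of a connected graph by branches.

  branch-corona⊆corona : ∀ {y v} → VC C y → corona (D G C y -ᵛ y) v → corona G v
  branch-corona⊆corona {y} {v} y∈C (T , (indep , maximum) , v∈T)
    -- The set `T` may contain neighbours of `y`, so the colour class on C has to miss `y`.
    with Branch.H-stable⁺ y∈C indep | opposite-avoiding y∈C
  ... | T⊆H , stable | m , y∉O = swapped ∪ˢ opposite m ,
      glue m swapped⊆off swapped-stable apart (≤-trans S₁≤S₀ (∣S∣≤∣swapped∣ smaller)) ,
      p⊆p∪q (opposite m) (q⊆p∪q (S₀ ─ H y∈C) T v∈T)
    where
    open Branch y∈C using (module Swap; ∩H-stable; H-stable⁻)
    open Swap S₀⊆off S₀-stable T⊆H stable
    smaller : ∣ S₀ ∩ H y∈C ∣ ≤ ∣ T ∣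
    smaller = maximum _ (H-stable⁻ (p∩q⊆q S₀ (H y∈C)) (∩H-stable S₀-stable))
    apart : ∀ {u w} → u ∈ swapped → w ∈ opposite m → ¬ Adj G u w
    apart u∈ w∈ uw with opposite⁻ m w∈ | x∈p∪q⁻ (S₀ ─ H y∈C) T u∈
    ... | w∈C , _ | inj₁ u∈S₀ = S₀-apart (p─q⊆p S₀ (H y∈C) u∈S₀) w∈C uw
    ... | w∈C , _ | inj₂ u∈T with H-next y∈C (T⊆H u∈T) uw
    ...   | inj₁ w∈H = proj₂ (off⁻ (H⊆off y∈C w∈H)) w∈C
    ...   | inj₂ refl = y∉O w∈

  -- Off C, `S` is as large as `S₁`; a stable set of the branch larger than the part of `S` there
  -- could be exchanged for it and would beat `S₁`.
  corona⊆branch-corona : ∀ {y v} (y∈C : VC C y) → v ∈ H y∈C → corona G v → corona (D G C y -ᵛ y) v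
  corona⊆branch-corona {y} {v} y∈C v∈H (S , maxS , v∈S) with split (proj₁ maxS)
  ... | S⊆off , stable , _ = (S ─ on) ∩ H y∈C ,
      (H-stable⁻ (p∩q⊆q (S ─ on) (H y∈C)) (∩H-stable stable) , bound) ,
      x∈p∩q⁺ (x∈p∧x∉q⇒x∈p─q v∈S (proj₂ (off⁻ (H⊆off y∈C v∈H)) ∘ on⁻) , v∈H)
    where
    open Branch y∈C using (module Swap; ∩H-stable; H-stable⁺; H-stable⁻)
    bound : ∀ T → Independent (D G C y -ᵛ y) T → ∣ T ∣ ≤ ∣ (S ─ on) ∩ H y∈C ∣
    bound T indep with H-stable⁺ indep
    ... | T⊆H , stableᵗ = +-cancelˡ-≤ ∣ S ─ on ─ H y∈C ∣ _ _ (begin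
      ∣ S ─ on ─ H y∈C ∣ + ∣ T ∣                    ≡⟨ sym ∣swapped∣ ⟩
      ∣ swapped ∣                                   ≤⟨ S₁-maximum swapped⊆off swapped-stable ⟩
      ∣ S₁ ∣                                        ≤⟨ ─on-large maxS ⟩
      ∣ S ─ on ∣                                    ≤⟨ ∣p∣≤∣p─q∣+∣p∩q∣ (S ─ on) (H y∈C) ⟩
      ∣ S ─ on ─ H y∈C ∣ + ∣ (S ─ on) ∩ H y∈C ∣     ∎)
      where
      open ≤-Reasoning
      open Swap S⊆off stable T⊆H stableᵗ

  -- Each time the walk uses an edge of C, restart from the end of that edge; the remaining piece
  -- then stays in G - E(C).
  reachable-from-cycle : ∀ {u v} → Reachable G u v → (∃ λ y → VC C y × Reachable G∖C y u) →
    ∃ λ y → VC C y × Reachable G∖C y v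
  reachable-from-cycle ε found = found
  reachable-from-cycle (_◅_ {u} {w} uw p) (y , y∈C , path) with EC? u w
  ... | yes uw∈C = reachable-from-cycle p (w , proj₂ (cycleEdge uw∈C) , ε)
  ... | no uw∉C = reachable-from-cycle p (y , y∈C , path ◅◅ ((uw , uw∉C) ◅ ε))

  connected⇒corona : Connected G →
    corona G ≐ (VC C ∪ (λ v → ∃ λ y → VC C y × corona (D G C y -ᵛ y) v))
  connected⇒corona (_ , connected) = decompose , [ VC⊆corona , (λ (_ , y∈C , v∈) → branch-corona⊆corona y∈C v∈) ]′
    where
    decompose : ∀ {v} → corona G v → VC C v ⊎ (∃ λ y → VC C y × corona (D G C y -ᵛ y) v)
    decompose {v} v∈corona@(S , ((S⊆V , _) , _) , v∈S) with VC? v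
    ... | yes v∈C = inj₁ v∈C
    ... | no v∉C with reachable-from-cycle (connected (VC⊆V (zero , refl)) (S⊆V v∈S)) (vertex C zero , (zero , refl) , ε)
    ...   | y , y∈C , path = inj₂ (y , y∈C , corona⊆branch-corona y∈C
              (Branch.H⁺ y∈C (S⊆V v∈S) (reach⁺ G∖C path) λ { refl → v∉C y∈C }) v∈corona)

theorem2p15 : ∀ {n : ℕ} (G : Graph n) (C : Cycle G) → IsUniqueOddCycle C → ¬ KönigEgerváry G →
    ((corona G ∪ N G (core G)) ≐ (_∈ V G))
    × (Connected G →
    corona G ≐ (VC C ∪ (λ v → ∃ λ y → VC C y × corona (D G C y -ᵛ y) v)))
theorem2p15 G C unique ¬KE = corona∪N-core , connected⇒corona
  where open NonKönigEgerváry G C unique ¬KE
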